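{- (i) For any $n=0,1,2,\ldots$ $$\int_O t^{q^n}\,dt=-\frac{1}{[n+1]}.$$ (ii) For any $n=0,1,2,\ldots$ $$\int_O f_n(t)\,dt=\frac{(-1)^{n+1}}{L_{n+1}}.$$ (iii) If $z\in K$, $|z|<1$, then $$\int_O C_s(z)\,ds=\log_C(z)-z .$$
   Context: Let $\mathbf F_q$ be the finite field with $q=p^\gamma$ elements ($p$ prime, $\gamma\ge 1$), and let $K=\mathbf F_q((x))$ with absolute value $|z|=q^{ -n}$ for $z=\sum_{i=n}^\infty\zeta_i x^i$, $\zeta_i\in\mathbf F_q$, $\zeta_n\neq 0$. Let $O=\{z\in K:|z|\le1\}$ and let $\overline{K}_c$ be the completion of an algebraic closure of $K$, with the extended absolute value. A function $u:O\to\overline{K}_c$ is $\mathbf F_q$-linear if it is additive and $u(\alpha t)=\alpha u(t)$ for all $\alpha\in\mathbf F_q$, $t\in O$. $C_0(O,\overline{K}_c)$ is the Banach space of continuous $\mathbf F_q$-linear functions $O\to\overline{K}_c$ with the supremum norm, and $C_0^1(O,\overline{K}_c)$ is the set of those $u\in C_0(O,\overline{K}_c)$ for which $t\mapsto t^{ -1}u(t)$ extends continuously from $O\setminus\{0\}$ to $O$. Put $[i]=x^{q^i}-x$; $D_0=L_0=1$; $D_i=[i]\,[i-1]^q\cdots[1]^{q^{i-1}}$, $L_i=[i][i-1]\cdots[1]$ for $i\ge1$. The normalized Carlitz polynomials are $f_i(t)=D_i^{ -1}e_i(t)$, $i\ge0$, where $e_0(t)=t$ and $e_i(t)=\prod_{m\in\mathbf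 F_q[x],\,\deg m<i}(t-m)$ for $i\ge1$ (including $m=0$). It is known that every $f\in C_0(O,\overline{K}_c)$ has a unique uniformly convergent expansion $f=\sum_{k\ge0}\varphi_kf_k$, $\varphi_k\in\overline{K}_c$, $\varphi_k\to0$. Indefinite sum: for $f\in C_0(O,\overline{K}_c)$, $Sf$ is the unique $u\in C_0(O,\overline{K}_c)$ satisfying $u(xt)-xu(t)=f(t)^q$ for all $t\in O$ and $u(1)=0$. (Explicitly, if $f=\sum_k\varphi_kf_k$ then $Sf=\sum_k\varphi_k^qf_{k+1}$.) Volkenborn-type integral: for $f\in C_0^1(O,\overline{K}_c)$, $$\int_Of(t)\,dt=\lim_{n\to\infty}\frac{(Sf)(x^n)}{x^n}=(Sf)'(0).$$ Carlitz module function: for $z\in K$, $|z|<1$ and $s\in O$, $C_s(z)=\sum_{i=0}^\infty f_i(s)z^{q^i}$; for fixed $z$ it is, as a function of $s$, an element of $C_0^1(O,\overline{K}_c)$, and $\int_OC_s(z)\,ds$ is its integral with respect to $s$. Carlitz logarithm: $\log_C(z)=\sum_{n=0}^\infty(-1)^n\frac{z^{q^n}}{L_n}$ for $|z|<1$. -}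

module Defs where

open import Level using (0ℓ; suc)
open import Algebra.Bundles using (CommutativeRing)
open import Algebra.Bundles.Raw using (RawRing)
open import Algebra.Apartness.Bundles using (HeytingField)
open import Algebra.Morphism.Structures using (IsRingHomomorphism)
import Algebra.Apartness.Properties.HeytingCommutativeRing as HCR
import Algebra.Definitions.RawSemiring as RawExp
import Algebra.Properties.CommutativeMonoid.Sum as MonoidSum
import Algebra.Properties.Ring as RingProperties
open import Data.Fin.Base as Fin using (Fin; toℕ; finToFun)
open import Data.Integer.Base as ℤ using (ℤ; +_; -[1+_]; 0ℤ)
import Data.Integer.Properties as ℤₚ
open import Data.List.Base using (List; []; _∷_; map)
open import Data.Nat.Base as ℕ using (ℕ; s≤s; z≤n)
import Data.Nat.Properties as ℕₚ
open import Data.Nat.Primality using (Prime; prime⇒nonTrivial)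
open import Data.Product.Base using (∃; ∃₂; _×_; _,_; proj₁; proj₂)
open import Data.Rational.Base as ℚ using (ℚ; 0ℚ; 1ℚ)
import Data.Rational.Properties as ℚₚ
open import Data.Rational.Literals using (fromℤ)
open import Function.Bundles using (Inverse; _⇔_; Equivalence)
open import Relation.Binary.PropositionalEquality as ≡ using (_≡_)
open import Relation.Nullary using (¬_; Dec; yes; no)

fromℤ-mono-< : ∀ {i j} → i ℤ.< j → fromℤ i ℚ.< fromℤ j
fromℤ-mono-< {i} {j} i<j =
  ℚ.*<* (≡.subst₂ ℤ._<_ (≡.sym (ℤₚ.*-identityʳ i)) (≡.sym (ℤₚ.*-identityʳ j)) i<j)

fromℤ-cancel-< : ∀ {i j} → fromℤ i ℚ.< fromℤ j → i ℤ.< j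
fromℤ-cancel-< {i} {j} (ℚ.*<* lt) =
  ≡.subst₂ ℤ._<_ (ℤₚ.*-identityʳ i) (ℤₚ.*-identityʳ j) lt

module FieldOps (E : HeytingField 0ℓ 0ℓ 0ℓ) where

  open HeytingField E public
    using (Carrier; _≈_; _#_; _+_; _*_; -_; 0#; 1#; heytingCommutativeRing; tight;
           #⇒invertible; invertible⇒#; #-irrefl; #-sym; #-cotrans)

  commutativeRing : CommutativeRing 0ℓ 0ℓ
  commutativeRing = record { isCommutativeRing = HeytingField.isCommutativeRing E }

  open CommutativeRing commutativeRing public
    using (_-_; setoid; ring; rawRing;
           +-commutativeMonoid; *-commutativeMonoid)
  open RawExp (RawRing.rawSemiring rawRing) public using (_^_)

  module ∑ = MonoidSum +-commutativeMonoid
  module ∏ = MonoidSum *-commutativeMonoid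

  ∑< : ℕ → (ℕ → Carrier) → Carrier
  ∑< n a = ∑.sum {n} (λ i → a (toℕ i))

  ∏< : ℕ → (ℕ → Carrier) → Carrier
  ∏< n a = ∏.sum {n} (λ i → a (toℕ i))

  infixl 7 _/_

  -- The denominator is given by a proof that it is apart from zero.
  _/_ : Carrier → ∀ {z} → z # 0# → Carrier
  a / z#0 = a * proj₁ (#⇒invertible z#0)

  -- Horner form; the list holds the non-leading coefficients, constant term
  -- first, so the degree is the length of the list.
  evalMonic : List Carrier → Carrier → Carrier
  evalMonic []       a = 1#
  evalMonic (c ∷ cs) a = c + a * evalMonic cs a

  *-#0 : ∀ {x y} → x # 0# → y # 0# → x * y # 0#
  *-#0 = HCR.x#0y#0→xy#0 heytingCommutativeRing

  1#0 : 1# # 0#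
  1#0 = HCR.1#0 heytingCommutativeRing

  ^-#0 : ∀ {x} → x # 0# → ∀ n → x ^ n # 0#
  ^-#0 x#0 ℕ.zero    = 1#0
  ^-#0 x#0 (ℕ.suc n) = *-#0 x#0 (^-#0 x#0 n)

  ∏-#0 : ∀ {n} (a : Fin n → Carrier) → (∀ i → a i # 0#) → ∏.sum a # 0#
  ∏-#0 {ℕ.zero}  a a#0 = 1#0
  ∏-#0 {ℕ.suc n} a a#0 = *-#0 (a#0 Fin.zero) (∏-#0 (λ i → a (Fin.suc i)) (λ i → a#0 (Fin.suc i)))

-- F((x)), given only as a raw ring: the isometric homomorphism into a field
-- in CompletedAlgebraicClosure is injective, so it transports the ring laws.
module Laurent (F : HeytingField 0ℓ 0ℓ 0ℓ) where

  private
    module F = FieldOps F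
    module FR = CommutativeRing F.commutativeRing
  open FR using (_≈_; 0#; 1#)

  record Series : Set where
    field
      coeff    : ℤ → F.Carrier
      order    : ℤ
      vanishes : ∀ i → i ℤ.< order → coeff i ≈ 0#
  open Series public

  infix 4 _≈K_
  _≈K_ : Series → Series → Set
  a ≈K b = ∀ i → coeff a i ≈ coeff b i

  infix 4 ∣_∣≤q^-_ ∣_∣<1

  -- ∣ z ∣≤q^- r  means  |z| ≤ q^(-r).
  ∣_∣≤q^-_ : Series → ℚ → Set
  ∣ z ∣≤q^- r = ∀ i → fromℤ i ℚ.< r → coeff z i ≈ 0#

  ∣_∣<1 : Series → Set
  ∣ z ∣<1 = ∃ λ r → 0ℚ ℚ.< r × ∣ z ∣≤q^- r

  private
    0*≈0 : ∀ {a b} → a ≈ 0# → a FR.* b ≈ 0#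
    0*≈0 a≈0 = FR.trans (FR.*-congʳ a≈0) (FR.zeroˡ _)

    *0≈0 : ∀ {a b} → b ≈ 0# → a FR.* b ≈ 0#
    *0≈0 b≈0 = FR.trans (FR.*-congˡ b≈0) (FR.zeroʳ _)

    0+0≈0 : ∀ {a b} → a ≈ 0# → b ≈ 0# → a FR.+ b ≈ 0#
    0+0≈0 a≈0 b≈0 = FR.trans (FR.+-cong a≈0 b≈0) (FR.+-identityˡ 0#)

    -0≈0 : ∀ {a} → a ≈ 0# → FR.- a ≈ 0#
    -0≈0 a≈0 = FR.trans (FR.-‿cong a≈0) (RingProperties.-0#≈0# FR.ring)

    ∑≈0 : ∀ n (a : ℕ → F.Carrier) → (∀ i → a i ≈ 0#) → F.∑< n a ≈ 0#
    ∑≈0 ℕ.zero    a a≈0 = FR.refl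
    ∑≈0 (ℕ.suc n) a a≈0 = 0+0≈0 (a≈0 0) (∑≈0 n (λ i → a (ℕ.suc i)) (λ i → a≈0 (ℕ.suc i)))

    sub-< : ∀ {k m n l} → k ℤ.< m ℤ.+ n → m ℤ.≤ l → k ℤ.- l ℤ.< n
    sub-< {k} {m} {n} {l} k<m+n m≤l = ℤₚ.<-≤-trans
      (ℤₚ.+-monoˡ-< (ℤ.- l) k<m+n)
      (≡.subst (m ℤ.+ n ℤ.- l ℤ.≤_) l+n-l≡n
        (ℤₚ.+-monoˡ-≤ (ℤ.- l) (ℤₚ.+-monoˡ-≤ n m≤l)))
      where
      l+n-l≡n : l ℤ.+ n ℤ.- l ≡ n
      l+n-l≡n = ≡.trans (≡.cong (ℤ._- l) (ℤₚ.+-comm l n))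
               (≡.trans (ℤₚ.+-assoc n l (ℤ.- l))
               (≡.trans (≡.cong (λ m → n ℤ.+ m) (ℤₚ.+-inverseʳ l)) (ℤₚ.+-identityʳ n)))

  infixl 6 _+K_ _-K_
  infixl 7 _*K_

  _+K_ : Series → Series → Series
  a +K b = record
    { coeff    = λ i → coeff a i FR.+ coeff b i
    ; order    = order a ℤ.⊓ order b
    ; vanishes = λ i lt → 0+0≈0
        (vanishes a i (ℤₚ.<-≤-trans lt (ℤₚ.i⊓j≤i (order a) (order b))))
        (vanishes b i (ℤₚ.<-≤-trans lt (ℤₚ.i⊓j≤j (order a) (order b))))
    }

  -K_ : Series → Series
  -K a = record
    { coeff    = λ i → FR.- coeff a i
    ; order    = order a
    ; vanishes = λ i lt → -0≈0 (vanishes a i lt)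
    }

  _-K_ : Series → Series → Series
  a -K b = a +K (-K b)

  -- All nonzero products aᵢ bⱼ with i + j = k have
  -- order a ≤ i ≤ k - order b.  If this range is empty, the absolute value
  -- in the number of summands only adds zero terms.
  mulTerm : Series → Series → ℤ → ℤ → F.Carrier
  mulTerm a b k i = coeff a i FR.* coeff b (k ℤ.- i)

  mulLength : Series → Series → ℤ → ℕ
  mulLength a b k = ℕ.suc ℤ.∣ k ℤ.- order a ℤ.- order b ∣

  mulCoeff : Series → Series → ℤ → F.Carrier
  mulCoeff a b k = F.∑< (mulLength a b k) (λ j → mulTerm a b k (order a ℤ.+ + j))

  _*K_ : Series → Series → Series
  a *K b = record
    { coeff    = mulCoeff a b
    ; order    = order a ℤ.+ order b
    ; vanishes = λ k lt → ∑≈0 (mulLength a b k) (λ j → mulTerm a b k (order a ℤ.+ + j))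
        (λ j → *0≈0 (vanishes b _ (sub-< lt (ℤₚ.i≤i+j (order a) (+ j)))))
    }

  polyCoeff : ∀ {n} → (Fin n → F.Carrier) → ℕ → F.Carrier
  polyCoeff {ℕ.zero}  c k         = 0#
  polyCoeff {ℕ.suc n} c ℕ.zero    = c Fin.zero
  polyCoeff {ℕ.suc n} c (ℕ.suc k) = polyCoeff (λ i → c (Fin.suc i)) k

  -- c₀ + c₁ x + ⋯ + cₙ₋₁ xⁿ⁻¹
  poly : ∀ {n} → (Fin n → F.Carrier) → Series
  poly {n} c = record
    { coeff    = polyℤ
    ; order    = 0ℤ
    ; vanishes = polyℤ-vanishes
    }
    where
    polyℤ : ℤ → F.Carrier
    polyℤ (+ k)    = polyCoeff c k
    polyℤ -[1+ k ] = 0#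

    polyℤ-vanishes : ∀ i → i ℤ.< 0ℤ → polyℤ i ≈ 0#
    polyℤ-vanishes (+ k)    (ℤ.+<+ ())
    polyℤ-vanishes -[1+ k ] _ = FR.refl

  const : F.Carrier → Series
  const α = poly {1} (λ _ → α)

  xK : Series
  xK = poly {2} λ { Fin.zero → 0# ; (Fin.suc _) → 1# }

  rawRingK : RawRing 0ℓ 0ℓ
  rawRingK = record
    { Carrier = Series
    ; _≈_     = _≈K_
    ; _+_     = _+K_
    ; _*_     = _*K_
    ; -_      = -K_
    ; 0#      = const 0#
    ; 1#      = const 1#
    }

  record O : Set where
    constructor _∈O
    field
      {val}    : Series
      integral : ∣ val ∣≤q^- 0ℚ
  open O public

  private
    poly-integral : ∀ {n} (c : Fin n → F.Carrier) → ∣ poly c ∣≤q^- 0ℚ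
    poly-integral c i i<0 = vanishes (poly c) i (fromℤ-cancel-< i<0)

    mulTerm-integral : ∀ (a b : O) k i → k ℤ.< 0ℤ → mulTerm (val a) (val b) k i ≈ 0#
    mulTerm-integral a b k i k<0 with i ℤₚ.<? 0ℤ
    ... | yes i<0 = 0*≈0 (integral a i (fromℤ-mono-< i<0))
    ... | no  i≮0 = *0≈0 (integral b (k ℤ.- i)
                      (fromℤ-mono-< (sub-< {m = 0ℤ} {n = 0ℤ} k<0 (ℤₚ.≮⇒≥ i≮0))))

  infixl 6 _+O_
  infixl 7 _*O_

  _+O_ : O → O → O
  a +O b = _∈O {val a +K val b} (λ i i<0 → 0+0≈0 (integral a i i<0) (integral b i i<0))

  _*O_ : O → O → O
  a *O b = _∈O {val a *K val b}
    (λ k k<0 → ∑≈0 (mulLength (val a) (val b) k) (λ j → mulTerm (val a) (val b) k (order (val a) ℤ.+ + j))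
      (λ j → mulTerm-integral a b k (order (val a) ℤ.+ + j) (fromℤ-cancel-< k<0)))

  -O_ : O → O
  -O a = _∈O { -K val a } (λ i i<0 → -0≈0 (integral a i i<0))

  constO : F.Carrier → O
  constO α = _∈O {const α} (poly-integral (λ _ → α))

  xO : O
  xO = _∈O {xK} (λ i i<0 → vanishes xK i (fromℤ-cancel-< i<0))

  rawRingO : RawRing 0ℓ 0ℓ
  rawRingO = record
    { Carrier = O
    ; _≈_     = λ a b → val a ≈K val b
    ; _+_     = _+O_
    ; _*_     = _*O_
    ; -_      = -O_
    ; 0#      = constO 0#
    ; 1#      = constO 1#
    }

  open RawExp (RawRing.rawSemiring rawRingO) public using () renaming (_^_ to _^O_)

-- A non-archimedean absolute value with values in {0} ∪ q^ℚ, presented by the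
-- relation |z| ≤ q^(-r); the real number |z| is the infimum of the q^(-r)
-- above it.
record AbsoluteValue (E : HeytingField 0ℓ 0ℓ 0ℓ) : Set (suc 0ℓ) where
  open FieldOps E
  infix 4 ∣_∣≤q^-_
  field
    ∣_∣≤q^-_    : Carrier → ℚ → Set
    resp        : ∀ {z w r} → z ≈ w → ∣ z ∣≤q^- r → ∣ w ∣≤q^- r
    antitone    : ∀ {z r s} → s ℚ.≤ r → ∣ z ∣≤q^- r → ∣ z ∣≤q^- s
    closed      : ∀ {z r} → (∀ s → s ℚ.< r → ∣ z ∣≤q^- s) → ∣ z ∣≤q^- r
    finite      : ∀ z → ∃ λ r → ∣ z ∣≤q^- r
    positive    : ∀ z → z # 0# ⇔ ∃ λ r → ¬ (∣ z ∣≤q^- r)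
    multiplicative : ∀ z w t → ∣ z * w ∣≤q^- t ⇔
                     (∃₂ λ r s → r ℚ.+ s ≡ t × ∣ z ∣≤q^- r × ∣ w ∣≤q^- s)
    ultrametric : ∀ {z w r} → ∣ z ∣≤q^- r → ∣ w ∣≤q^- r → ∣ z + w ∣≤q^- r

  Limit : (ℕ → Carrier) → Carrier → Set
  Limit a l = ∀ r → ∃ λ N → ∀ n → N ℕ.≤ n → ∣ a n - l ∣≤q^- r

  Cauchy : (ℕ → Carrier) → Set
  Cauchy a = ∀ r → ∃ λ N → ∀ m n → N ℕ.≤ m → N ℕ.≤ n → ∣ a m - a n ∣≤q^- r

  HasSum : (ℕ → Carrier) → Carrier → Set
  HasSum a = Limit (λ n → ∑< n a)

-- An algebraic closure and its completion are given up to isomorphism, by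
-- their defining properties, and so are quantified over rather than
-- constructed.  The composite F((x)) → closure → completion is isometric.
record CompletedAlgebraicClosure (F : HeytingField 0ℓ 0ℓ 0ℓ) : Set (suc 0ℓ) where
  open Laurent F using (Series; rawRingK) renaming (∣_∣≤q^-_ to ∣_∣K≤q^-_)

  field
    closure : HeytingField 0ℓ 0ℓ 0ℓ
  module A = FieldOps closure
  field
    ι₁               : Series → A.Carrier
    ι₁-homomorphism  : IsRingHomomorphism rawRingK A.rawRing ι₁
    algebraic        : ∀ a → ∃ λ cs → A.evalMonic (map ι₁ cs) a A.≈ A.0#
    algebraicallyClosed : ∀ c cs → ∃ λ a → A.evalMonic (c ∷ cs) a A.≈ A.0#
    absA             : AbsoluteValue closure
  module ∣A∣ = AbsoluteValue absA
  field
    ι₁-isometry      : ∀ z r → ∣ z ∣K≤q^- r ⇔ ∣A∣.∣ ι₁ z ∣≤q^- r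

  field
    completion : HeytingField 0ℓ 0ℓ 0ℓ
  module C = FieldOps completion
  field
    ι₂               : A.Carrier → C.Carrier
    ι₂-homomorphism  : IsRingHomomorphism A.rawRing C.rawRing ι₂
    absC             : AbsoluteValue completion
  module ∣C∣ = AbsoluteValue absC
  field
    ι₂-isometry      : ∀ a r → ∣A∣.∣ a ∣≤q^- r ⇔ ∣C∣.∣ ι₂ a ∣≤q^- r
    dense            : ∀ z r → ∃ λ a → ∣C∣.∣ z C.- ι₂ a ∣≤q^- r
    complete         : ∀ s → ∣C∣.Cauchy s → ∃ λ l → ∣C∣.Limit s l

module Carlitz
  {p γ : ℕ} (p-prime : Prime p) (γ≥1 : 1 ℕ.≤ γ)
  (F : HeytingField 0ℓ 0ℓ 0ℓ)
  (card : Inverse (≡.setoid (Fin (p ℕ.^ γ))) (FieldOps.setoid F))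
  (K̄c : CompletedAlgebraicClosure F)
  where

  q : ℕ
  q = p ℕ.^ γ

  open Laurent F public using (Series; O; val; _-K_; _+O_; _*O_; _^O_; const; constO; xK; xO; poly; ∣_∣<1)
    renaming (∣_∣≤q^-_ to ∣_∣K≤q^-_)
  open CompletedAlgebraicClosure K̄c
  open FieldOps completion public
  open AbsoluteValue absC public
  private
    module F = FieldOps F
    open module K = Laurent F using (-K_; coeff; vanishes)
    module CR = CommutativeRing commutativeRing
    module CP = RingProperties ring
    module H₁ = IsRingHomomorphism ι₁-homomorphism
    module H₂ = IsRingHomomorphism ι₂-homomorphism

  ι : Series → Carrier
  ι z = ι₂ (ι₁ z)

  ιO : O → Carrier
  ιO t = ι (val t)

  X : Carrier
  X = ι xK

  [_] : ℕ → Carrier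
  [ i ] = X ^ (q ℕ.^ i) - X

  -- Dᵢ = ∏_{k=1}^{i} [k]^(q^(i-k))  and  Lᵢ = ∏_{k=1}^{i} [k]
  D : ℕ → Carrier
  D i = ∏< i (λ k → [ ℕ.suc k ] ^ (q ℕ.^ (i ℕ.∸ ℕ.suc k)))

  L : ℕ → Carrier
  L i = ∏< i (λ k → [ ℕ.suc k ])

  private
    isometry : ∀ z r → ∣ z ∣K≤q^- r ⇔ ∣ ι z ∣≤q^- r
    isometry z r = record
      { to        = λ h → Equivalence.to (ι₂-isometry (ι₁ z) r) (Equivalence.to (ι₁-isometry z r) h)
      ; from      = λ h → Equivalence.from (ι₁-isometry z r) (Equivalence.from (ι₂-isometry (ι₁ z) r) h)
      ; to-cong   = λ { ≡.refl → ≡.refl }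
      ; from-cong = λ { ≡.refl → ≡.refl }
      }

    ι-1 : ι (const F.1#) ≈ 1#
    ι-1 = CR.trans (H₂.⟦⟧-cong H₁.1#-homo) H₂.1#-homo

    ∣1∣≤1 : ∣ 1# ∣≤q^- 0ℚ
    ∣1∣≤1 = resp ι-1 (Equivalence.to (isometry (const F.1#) 0ℚ)
      (λ i i<0 → vanishes (const F.1#) i (fromℤ-cancel-< i<0)))

    *-≤ : ∀ {z w} r s → ∣ z ∣≤q^- r → ∣ w ∣≤q^- s → ∣ z * w ∣≤q^- (r ℚ.+ s)
    *-≤ r s zr ws = Equivalence.from (multiplicative _ _ _) (r , s , ≡.refl , zr , ws)

    ∣-1∣≤1 : ∣ - 1# ∣≤q^- 0ℚ
    ∣-1∣≤1 = resp (CR.trans (CR.trans (H₂.⟦⟧-cong (H₁.-‿homo (const F.1#))) (H₂.-‿homo _)) (CR.-‿cong ι-1))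
      (Equivalence.to (isometry (-K const F.1#) 0ℚ)
        (λ i i<0 → vanishes (-K const F.1#) i (fromℤ-cancel-< i<0)))

    neg-≤ : ∀ {z r} → ∣ z ∣≤q^- r → ∣ - z ∣≤q^- r
    neg-≤ {z} {r} zr = resp (CP.-1*x≈-x z)
      (≡.subst (∣ - 1# * z ∣≤q^-_) (ℚₚ.+-identityˡ r) (*-≤ 0ℚ r ∣-1∣≤1 zr))

    xK-coeff : ∀ i → i ℤ.< + 1 → coeff xK i F.≈ F.0#
    xK-coeff (+ ℕ.zero)    _ = HeytingField.refl F
    xK-coeff (+ (ℕ.suc n)) (ℤ.+<+ (s≤s ()))
    xK-coeff -[1+ n ]      _ = HeytingField.refl F

    ∣X∣≤q⁻¹ : ∣ X ∣≤q^- 1ℚ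
    ∣X∣≤q⁻¹ = Equivalence.to (isometry xK 1ℚ) (λ i i<1 → xK-coeff i (fromℤ-cancel-< i<1))

    ∣X∣≰q⁻² : ¬ (∣ X ∣≤q^- fromℤ (+ 2))
    ∣X∣≰q⁻² h = F.#-irrefl 1≈0 F.1#0
      where
      1≈0 : F.1# F.≈ F.0#
      1≈0 = Equivalence.from (isometry xK _) h (+ 1) (fromℤ-mono-< {+ 1} {+ 2} (ℤ.+<+ (s≤s (s≤s z≤n))))

    ∣Xⁿ∣≤1 : ∀ n → ∣ X ^ n ∣≤q^- 0ℚ
    ∣Xⁿ∣≤1 ℕ.zero    = ∣1∣≤1
    ∣Xⁿ∣≤1 (ℕ.suc n) = *-≤ 0ℚ 0ℚ (antitone (ℚₚ.<⇒≤ (fromℤ-mono-< {+ 0} {+ 1} (ℤ.+<+ (s≤s z≤n)))) ∣X∣≤q⁻¹) (∣Xⁿ∣≤1 n)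

    ∣Xⁿ∣≤q⁻² : ∀ {n} → 2 ℕ.≤ n → ∣ X ^ n ∣≤q^- fromℤ (+ 2)
    ∣Xⁿ∣≤q⁻² (s≤s (s≤s {n = n} _)) = *-≤ 1ℚ 1ℚ ∣X∣≤q⁻¹ (*-≤ 1ℚ 0ℚ ∣X∣≤q⁻¹ (∣Xⁿ∣≤1 n))

    2≤m^[1+n] : ∀ {m} → 2 ℕ.≤ m → ∀ n → 2 ℕ.≤ m ℕ.^ ℕ.suc n
    2≤m^[1+n] {m} 2≤m n = ℕₚ.≤-trans 2≤m
      (ℕₚ.m≤m*n m (m ℕ.^ n) {{ℕₚ.m^n≢0 m n {{ℕ.>-nonZero (ℕₚ.≤-trans (s≤s z≤n) 2≤m)}}}})

    2≤m^n : ∀ {m n} → 2 ℕ.≤ m → 1 ℕ.≤ n → 2 ℕ.≤ m ℕ.^ n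
    2≤m^n 2≤m (s≤s {n = n} _) = 2≤m^[1+n] 2≤m n

    2≤q : 2 ℕ.≤ q
    2≤q = 2≤m^n (ℕ.nonTrivial⇒n>1 p {{prime⇒nonTrivial p-prime}}) γ≥1

    cancel : ∀ a → a - (a - X) ≈ X
    cancel a = CR.trans (CR.+-congˡ (CP.⁻¹-anti-homo‿- a X))
      (CR.trans (CR.+-comm a (X - a))
      (CR.trans (CR.+-assoc X (- a) a)
      (CR.trans (CR.+-congˡ (CR.-‿inverseˡ a)) (CR.+-identityʳ X))))

  X#0 : X # 0#
  X#0 = Equivalence.from (positive X) (fromℤ (+ 2) , ∣X∣≰q⁻²)

  []#0 : ∀ k → [ ℕ.suc k ] # 0#
  []#0 k = Equivalence.from (positive _) (fromℤ (+ 2) , λ h →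
    ∣X∣≰q⁻² (resp (cancel _) (ultrametric (∣Xⁿ∣≤q⁻² (2≤m^[1+n] 2≤q k)) (neg-≤ h))))

  D#0 : ∀ i → D i # 0#
  D#0 i = ∏-#0 _ (λ (k : Fin i) → ^-#0 ([]#0 (toℕ k)) (q ℕ.^ (i ℕ.∸ ℕ.suc (toℕ k))))

  L#0 : ∀ i → L i # 0#
  L#0 i = ∏-#0 _ (λ (k : Fin i) → []#0 (toℕ k))

  -- finToFun runs through all maps Fin i → Fin q, hence through the
  -- coefficient vectors of all polynomials of degree < i.
  polyOfDegree< : ∀ i → Fin (q ℕ.^ i) → Series
  polyOfDegree< i k = poly (λ j → Inverse.to card (finToFun {q} {i} k j))

  e : ℕ → O → Carrier
  e ℕ.zero    t = ιO t
  e (ℕ.suc i) t = ∏.sum (λ k → ιO t - ι (polyOfDegree< (ℕ.suc i) k))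

  f : ℕ → O → Carrier
  f i t = e i t / D#0 i

  Continuous : (O → Carrier) → Set
  Continuous u = ∀ t r → ∃ λ s → ∀ t′ → ∣ val t′ -K val t ∣K≤q^- s → ∣ u t′ - u t ∣≤q^- r

  record C₀ (u : O → Carrier) : Set where
    field
      continuous  : Continuous u
      additive    : ∀ s t → u (s +O t) ≈ u s + u t
      homogeneous : ∀ α t → u (constO α *O t) ≈ ι (const α) * u t

  record C₀¹ (u : O → Carrier) : Set where
    field
      inC₀       : C₀ u
      quotient   : O → Carrier
      quotient-continuous : Continuous quotient
      quotient-extends    : ∀ t (t#0 : ιO t # 0#) → quotient t ≈ u t / t#0

  record IsIndefiniteSum (g u : O → Carrier) : Set where
    field
      inC₀       : C₀ u
      difference : ∀ t → u (xO *O t) - X * u t ≈ g t ^ q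
      initial    : u (constO F.1#) ≈ 0#

  -- ∫_O g(t) dt = I, with S the indefinite sum of g; g ∈ C₀¹ and the
  -- existence and uniqueness of S are part of the assertion.
  record HasIntegral (g : O → Carrier) (I : Carrier) : Set where
    field
      inC₀¹  : C₀¹ g
      S      : O → Carrier
      S-sum  : IsIndefiniteSum g S
      S-unique : ∀ u → IsIndefiniteSum g u → ∀ t → u t ≈ S t
      limit  : Limit (λ n → S (xO ^O n) / ^-#0 X#0 n) I

  IsCarlitzFunction : Series → (O → Carrier) → Set
  IsCarlitzFunction z C = ∀ s → HasSum (λ i → f i s * ι z ^ (q ℕ.^ i)) (C s)

  IsCarlitzLog : Series → Carrier → Set
  IsCarlitzLog z = HasSum (λ n → (- 1#) ^ n * (ι z ^ (q ℕ.^ n) / L#0 n))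

{-# OPTIONS --safe #-}
module Submission where

-- Put g(t) = t H(t) and let the indefinite sum of g be t R(t), with R
-- continuous; then (Sg)(xⁿ) / xⁿ = R(xⁿ), so the integral is R(0).  In each
-- case the indefinite sum is explicit: for t^(qⁿ) it is (t^(qⁿ⁺¹) - t) / [n+1],
-- for fₙ it is fₙ₊₁, and for C_t(z) it is C_t(z) - t z.  It is unique because a
-- difference w of two solutions obeys w(α + x t) = x w(t) = w(x t), so that
-- for every n there is t′ with w(t) = w(xⁿ t′), while w is continuous.
--
-- The Carlitz polynomials enter only through [i+1] fᵢ₊₁ = fᵢ^q - fᵢ, which comes
-- from ∏_α (T - α) = T^q - T.  It implies fᵢ₊₁(x t) = x fᵢ₊₁(t) + fᵢ(t)^q, whence
-- |fᵢ| ≤ 1 on O, and also |fᵢ(t) / t| ≤ q^i with value (-1)^i / Lᵢ at t = 0; so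
-- C_t(z) / t = Σ (fᵢ(t) / t) z^(q^i) converges uniformly to a continuous
-- function whose value at 0 is log_C z.

open import Level using (0ℓ)
open import Algebra.Apartness.Bundles using (HeytingField)
import Algebra.Apartness.Properties.HeytingCommutativeRing as HCR
open import Algebra.Bundles using (CommutativeMonoid; CommutativeRing)
open import Algebra.Morphism.Structures using (IsRingHomomorphism)
import Algebra.Properties.AbelianGroup as AbelianGroupProperties
import Algebra.Properties.CommutativeMonoid.Sum as MonoidSum
import Algebra.Properties.CommutativeSemiring.Exp as CommExp
import Algebra.Properties.Group as GroupProperties
import Algebra.Properties.Ring as RingProperties
import Algebra.Properties.Semiring.Exp as Exp
import Algebra.Properties.Semiring.Mult.TCOptimised as Mult
import Algebra.Solver.Ring as RingSolver
open import Algebra.Solver.Ring.AlmostCommutativeRing using (fromCommutativeRing; _-Raw-AlmostCommutative⟶_)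
open import Data.Fin.Base as Fin using (Fin; finToFun; toℕ)
import Data.Fin.Permutation as Perm
import Data.Fin.Properties as Finₚ
open import Data.Integer.Base as ℤ using (ℤ; +_; -[1+_]; 0ℤ; 1ℤ)
import Data.Integer.Properties as ℤₚ
open import Data.List.Base using (List; []; _∷_; length)
open import Data.Maybe.Base using (Maybe; just; nothing)
open import Data.Nat.Base as ℕ using (ℕ; s≤s; z≤n)
open import Data.Nat.Primality using (Prime; prime⇒nonTrivial)
import Data.Nat.Properties as ℕₚ
open import Data.Product.Base using (∃; ∃₂; _×_; _,_; proj₁; proj₂)
open import Data.Rational.Base as ℚ using (ℚ; 0ℚ; 1ℚ)
open import Data.Rational.Literals using (fromℤ)
import Data.Rational.Properties as ℚₚ
open import Data.Rational.Solver using (module +-*-Solver)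
import Data.Rational.Unnormalised.Base as ℚᵘ
import Data.Rational.Unnormalised.Properties as ℚᵘₚ
open import Data.Sum.Base using (inj₁; inj₂)
open import Data.Vec.Functional using () renaming (_∷_ to infixr 5 _∷ᵛ_)
open import Function.Base using (_∘_)
open import Function.Bundles using (Equivalence; Inverse)
open import Relation.Binary.PropositionalEquality as ≡ using (_≡_; _≢_; _≗_)
import Relation.Binary.Reasoning.Setoid as SetoidReasoning
open import Relation.Nullary using (Dec; ¬_; contradiction; no; yes)
open import Defs

-- Each quotient by t is instead a formula valid on all of O: f_i^q - f_i = f_i (f_i^(q-1) - 1)
-- turns the recursion for the Carlitz polynomials into a product formula for f_i(t) / t, and the
-- Carlitz function is built from its quotient, not the other way round. The recursion serves as the
-- definition of `f̂`. It is matched with the products over polynomials only afterwards, by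
-- splitting off the leading coefficient, and this requires f_n(x^n) = 1. The quantitative input is
-- |x| ≤ 1/q against |1/[k]| ≤ q: one factor x compensates exactly one division by [k]. Series carry
-- the fixed rate q^(-n), so uniformity in t needs no separate argument.

module IntegerSolver (R : CommutativeRing 0ℓ 0ℓ) where

  open CommutativeRing R
  open RingProperties ring
  open Mult semiring renaming (_×_ to _·_; 1+× to 1+·; ×-homo-+ to ·-homo-+; ×1-homo-* to ·1-homo-*)
  open SetoidReasoning setoid

  private
    [x+y]-[x+z] : ∀ x y z → (x + y) - (x + z) ≈ y - z
    [x+y]-[x+z] x y z = begin
      (x + y) - (x + z)       ≈⟨ +-cong (+-comm x y) (-‿cong (+-comm x z)) ⟩
      (y + x) - (z + x)       ≈⟨ +-congˡ (-‿anti-homo-+ z x) ⟩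
      (y + x) + (- x + - z)   ≈⟨ +-assoc y x _ ⟩
      y + (x + (- x + - z))   ≈⟨ +-congˡ (+-assoc x (- x) (- z)) ⟨
      y + ((x + - x) + - z)   ≈⟨ +-congˡ (+-congʳ (-‿inverseʳ x)) ⟩
      y + (0# + - z)          ≈⟨ +-congˡ (+-identityˡ (- z)) ⟩
      y - z                   ∎

    ⟦_⟧ : ℤ → Carrier
    ⟦ + n ⟧      = n · 1#
    ⟦ -[1+ n ] ⟧ = - (ℕ.suc n · 1#)

    ⟦⟧-⊖ : ∀ m n → ⟦ m ℤ.⊖ n ⟧ ≈ m · 1# - n · 1#
    ⟦⟧-⊖ m         ℕ.zero    = sym (trans (+-congˡ -0#≈0#) (+-identityʳ _))
    ⟦⟧-⊖ ℕ.zero    (ℕ.suc n) = sym (+-identityˡ _)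
    ⟦⟧-⊖ (ℕ.suc m) (ℕ.suc n) = begin
      ⟦ ℕ.suc m ℤ.⊖ ℕ.suc n ⟧         ≡⟨ ≡.cong ⟦_⟧ (ℤₚ.[1+m]⊖[1+n]≡m⊖n m n) ⟩
      ⟦ m ℤ.⊖ n ⟧                     ≈⟨ ⟦⟧-⊖ m n ⟩
      m · 1# - n · 1#                 ≈⟨ [x+y]-[x+z] 1# _ _ ⟨
      (1# + m · 1#) - (1# + n · 1#)   ≈⟨ +-cong (1+· m 1#) (-‿cong (1+· n 1#)) ⟨
      ℕ.suc m · 1# - ℕ.suc n · 1#     ∎

    ⟦⟧-+ : ∀ i j → ⟦ i ℤ.+ j ⟧ ≈ ⟦ i ⟧ + ⟦ j ⟧
    ⟦⟧-+ (+ m)      (+ n)      = ·-homo-+ 1# m n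
    ⟦⟧-+ (+ m)      -[1+ n ]   = ⟦⟧-⊖ m (ℕ.suc n)
    ⟦⟧-+ -[1+ m ]   (+ n)      = trans (⟦⟧-⊖ n (ℕ.suc m)) (+-comm _ _)
    ⟦⟧-+ -[1+ m ]   -[1+ n ]   = begin
      - (ℕ.suc (ℕ.suc (m ℕ.+ n)) · 1#)          ≡⟨ ≡.cong (λ k → - (ℕ.suc k · 1#)) (ℕₚ.+-suc m n) ⟨
      - ((ℕ.suc m ℕ.+ ℕ.suc n) · 1#)            ≈⟨ -‿cong (·-homo-+ 1# (ℕ.suc m) (ℕ.suc n)) ⟩
      - (ℕ.suc m · 1# + ℕ.suc n · 1#)           ≈⟨ ⁻¹-∙-comm _ _ ⟨
      - (ℕ.suc m · 1#) + - (ℕ.suc n · 1#)       ∎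
      where
      open AbelianGroupProperties +-abelianGroup using (⁻¹-∙-comm)

    ⟦⟧-neg : ∀ i → ⟦ ℤ.- i ⟧ ≈ - ⟦ i ⟧
    ⟦⟧-neg (+ ℕ.zero)    = sym -0#≈0#
    ⟦⟧-neg (+ (ℕ.suc n)) = refl
    ⟦⟧-neg -[1+ n ]      = sym (-‿involutive _)

    ⟦⟧-*-pos : ∀ m j → ⟦ + m ℤ.* j ⟧ ≈ ⟦ + m ⟧ * ⟦ j ⟧
    ⟦⟧-*-pos m (+ n) = trans (reflexive (≡.cong ⟦_⟧ (≡.sym (ℤₚ.pos-* m n)))) (·1-homo-* m n)
    ⟦⟧-*-pos m -[1+ n ] = begin
      ⟦ + m ℤ.* (ℤ.- + ℕ.suc n) ⟧     ≡⟨ ≡.cong ⟦_⟧ (ℤₚ.neg-distribʳ-* (+ m) (+ ℕ.suc n)) ⟨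
      ⟦ ℤ.- (+ m ℤ.* + ℕ.suc n) ⟧     ≈⟨ ⟦⟧-neg (+ m ℤ.* + ℕ.suc n) ⟩
      - ⟦ + m ℤ.* + ℕ.suc n ⟧         ≈⟨ -‿cong (⟦⟧-*-pos m (+ ℕ.suc n)) ⟩
      - (⟦ + m ⟧ * ⟦ + ℕ.suc n ⟧)     ≈⟨ -‿distribʳ-* _ _ ⟩
      ⟦ + m ⟧ * - ⟦ + ℕ.suc n ⟧       ∎

    ⟦⟧-* : ∀ i j → ⟦ i ℤ.* j ⟧ ≈ ⟦ i ⟧ * ⟦ j ⟧
    ⟦⟧-* (+ m)    j = ⟦⟧-*-pos m j
    ⟦⟧-* -[1+ m ] j = begin
      ⟦ (ℤ.- + ℕ.suc m) ℤ.* j ⟧       ≡⟨ ≡.cong ⟦_⟧ (ℤₚ.neg-distribˡ-* (+ ℕ.suc m) j) ⟨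
      ⟦ ℤ.- (+ ℕ.suc m ℤ.* j) ⟧       ≈⟨ ⟦⟧-neg (+ ℕ.suc m ℤ.* j) ⟩
      - ⟦ + ℕ.suc m ℤ.* j ⟧           ≈⟨ -‿cong (⟦⟧-*-pos (ℕ.suc m) j) ⟩
      - (⟦ + ℕ.suc m ⟧ * ⟦ j ⟧)       ≈⟨ -‿distribˡ-* _ _ ⟩
      - ⟦ + ℕ.suc m ⟧ * ⟦ j ⟧         ∎

    morphism : ℤ.+-*-rawRing -Raw-AlmostCommutative⟶ fromCommutativeRing R
    morphism = record
      { ⟦_⟧    = ⟦_⟧
      ; +-homo = ⟦⟧-+
      ; *-homo = ⟦⟧-*
      ; -‿homo = ⟦⟧-neg
      ; 0-homo = refl
      ; 1-homo = refl
      }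

    -- Equality in the ring cannot be tested, so the solver normalises with integer coefficients.
    -- Distinct integers may still have equal images in the ring; `nothing` only means that the
    -- solver does not identify them.
    _≟_ : ∀ i j → Maybe (⟦ i ⟧ ≈ ⟦ j ⟧)
    i ≟ j with i ℤₚ.≟ j
    ... | yes i≡j = just (reflexive (≡.cong ⟦_⟧ i≡j))
    ... | no _    = nothing

  open RingSolver ℤ.+-*-rawRing (fromCommutativeRing R) morphism _≟_ public
    using (solve; con; _:=_; _:+_; _:*_; _:-_; :-_)

-- Division, monic polynomials and the q-th power map in a Heyting field.

module FieldProperties (E : HeytingField 0ℓ 0ℓ 0ℓ) where

  open FieldOps E
  open CommutativeRing commutativeRing
    hiding (Carrier; _≈_; _+_; _*_; -_; 0#; 1#; _-_; setoid; ring; rawRing; +-commutativeMonoid; *-commutativeMonoid)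
  open IntegerSolver commutativeRing
  open SetoidReasoning setoid
  open RingProperties ring using (-0#≈0#)
  open HCR heytingCommutativeRing using (x-0≈x)
  open Exp semiring using (^-congˡ)
  open CommExp commutativeSemiring using (^-distrib-*)

  -- Tightness makes equality the negation of apartness, hence stable under double negation.
  -- Equations may therefore be proved by the cases `x ≈ 0#` and `x # 0#`, although neither can be
  -- decided.
  ≈-stable : ∀ {x y} → ¬ ¬ (x ≈ y) → x ≈ y
  ≈-stable {x} {y} ¬x≉y = proj₁ (tight x y) λ x#y → ¬x≉y λ x≈y → proj₂ (tight x y) x≈y x#y

  ≉⇒¬¬# : ∀ {x y} → ¬ (x ≈ y) → ¬ ¬ (x # y)
  ≉⇒¬¬# x≉y ¬x#y = x≉y (proj₁ (tight _ _) ¬x#y)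

  [x/z]*z : ∀ x {z} (z#0 : z # 0#) → (x / z#0) * z ≈ x
  [x/z]*z x {z} z#0 with v , vz≈1 , _ ← #⇒invertible z#0 = begin
    (x * v) * z         ≈⟨ *-assoc x v z ⟩
    x * (v * z)         ≈⟨ *-congˡ (*-congˡ (x-0≈x z)) ⟨
    x * (v * (z - 0#))  ≈⟨ *-congˡ vz≈1 ⟩
    x * 1#              ≈⟨ *-identityʳ x ⟩
    x                   ∎

  *-cancelʳ-# : ∀ {x y z} → z # 0# → x * z ≈ y * z → x ≈ y
  *-cancelʳ-# {x} {y} {z} z#0 xz≈yz = begin
    x                     ≈⟨ lemma x ⟨
    x * z * (1# / z#0)    ≈⟨ *-congʳ xz≈yz ⟩
    y * z * (1# / z#0)    ≈⟨ lemma y ⟩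
    y                     ∎
    where
    lemma : ∀ w → w * z * (1# / z#0) ≈ w
    lemma w = trans (*-assoc w z _) (trans (*-congˡ (trans (*-comm z _) ([x/z]*z 1# z#0))) (*-identityʳ w))

  /-unique : ∀ {x y z} (z#0 : z # 0#) → x * z ≈ y → x ≈ y / z#0
  /-unique z#0 xz≈y = *-cancelʳ-# z#0 (trans xz≈y (sym ([x/z]*z _ z#0)))

  *≉0 : ∀ {x y} → ¬ (x ≈ 0#) → ¬ (y ≈ 0#) → ¬ (x * y ≈ 0#)
  *≉0 x≉0 y≉0 xy≈0 = ≉⇒¬¬# y≉0 λ y#0 → x≉0 (*-cancelʳ-# y#0 (trans xy≈0 (sym (zeroˡ _))))

  0^n≈0 : ∀ {x n} → 1 ℕ.≤ n → x ≈ 0# → x ^ n ≈ 0#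
  0^n≈0 (s≤s _) x≈0 = trans (*-congʳ x≈0) (zeroˡ _)

  ∑<-last : ∀ n (a : ℕ → Carrier) → ∑< (ℕ.suc n) a ≈ ∑< n a + a n
  ∑<-last ℕ.zero    a = +-comm _ _
  ∑<-last (ℕ.suc n) a = trans (+-congˡ (∑<-last n (a ∘ ℕ.suc))) (sym (+-assoc _ _ _))

  ∏<-last : ∀ n (a : ℕ → Carrier) → ∏< (ℕ.suc n) a ≈ ∏< n a * a n
  ∏<-last ℕ.zero    a = *-comm _ _
  ∏<-last (ℕ.suc n) a = trans (*-congˡ (∏<-last n (a ∘ ℕ.suc))) (sym (*-assoc _ _ _))

  -- Synthetic division: the coefficients of the quotient are the intermediate values of Horner's
  -- scheme at `a`.
  factor : ∀ c cs a → ∃ λ ds → length ds ≡ length cs ×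
    (∀ T → evalMonic (c ∷ cs) T - evalMonic (c ∷ cs) a ≈ (T - a) * evalMonic ds T)
  factor c [] a = [] , ≡.refl , λ T →
    solve 3 (λ c T a → (c :+ T :* con (+ 1)) :- (c :+ a :* con (+ 1)) := (T :- a) :* con (+ 1)) refl c T a
  factor c (c′ ∷ cs) a with ds , eq , h ← factor c′ cs a =
    d a ∷ ds , ≡.cong ℕ.suc eq , λ T → begin
      (c + T * d T) - (c + a * d a)              ≈⟨ solve 5 (λ c T a u v → (c :+ T :* u) :- (c :+ a :* v) := T :* (u :- v) :+ (T :- a) :* v) refl c T a (d T) (d a) ⟩
      T * (d T - d a) + (T - a) * d a            ≈⟨ +-congʳ (*-congˡ (h T)) ⟩
      T * ((T - a) * evalMonic ds T) + (T - a) * d a ≈⟨ solve 4 (λ T a m v → T :* ((T :- a) :* m) :+ (T :- a) :* v := (T :- a) :* (v :+ T :* m)) refl T a (evalMonic ds T) (d a) ⟩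
      (T - a) * (d a + T * evalMonic ds T)       ∎
    where d = evalMonic (c′ ∷ cs)

  -- Dividing out the first root leaves the others as roots of the quotient, because the factor
  -- `a i - a₀` can be cancelled. This is why the roots are required to be apart and not merely
  -- unequal.
  evalMonic≈∏ : ∀ {n} cs → length cs ≡ n → (a : Fin n → Carrier) →
    (∀ i → evalMonic cs (a i) ≈ 0#) → (∀ {i j} → i ≢ j → a i - a j # 0#) →
    ∀ T → evalMonic cs T ≈ ∏.sum (λ i → T - a i)
  evalMonic≈∏ {ℕ.zero}  []       _ a root distinct T = refl
  evalMonic≈∏ {ℕ.suc n} (c ∷ cs) len a root distinct T with ds , eq , h ← factor c cs (a Fin.zero) = begin
    evalMonic (c ∷ cs) T                        ≈⟨ divided T ⟩
    (T - a₀) * evalMonic ds T                   ≈⟨ *-congˡ (evalMonic≈∏ ds (≡.trans eq (ℕₚ.suc-injective len)) (a ∘ Fin.suc) root′ (λ i≢j → distinct (λ { ≡.refl → i≢j ≡.refl })) T) ⟩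
    (T - a₀) * ∏.sum (λ i → T - a (Fin.suc i))  ∎
    where
    a₀ = a Fin.zero
    divided : ∀ T → evalMonic (c ∷ cs) T ≈ (T - a₀) * evalMonic ds T
    divided T = trans (sym (trans (+-congˡ (trans (-‿cong (root Fin.zero)) -0#≈0#)) (+-identityʳ _))) (h T)
    root′ : ∀ i → evalMonic ds (a (Fin.suc i)) ≈ 0#
    root′ i = *-cancelʳ-# (distinct {Fin.suc i} {Fin.zero} λ ())
      (trans (*-comm _ _) (trans (sym (divided _)) (trans (root (Fin.suc i)) (sym (zeroˡ _)))))

  monic-*-linear : ∀ U cs → ∃₂ λ d ds → length ds ≡ length cs ×
    (∀ T → evalMonic (d ∷ ds) T ≈ (T + U) * evalMonic cs T)
  monic-*-linear U [] = U , [] , ≡.refl , λ T →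
    solve 2 (λ U T → U :+ T :* con (+ 1) := (T :+ U) :* con (+ 1)) refl U T
  monic-*-linear U (c ∷ cs) with d , ds , eq , h ← monic-*-linear U cs =
    U * c , c + d ∷ ds , ≡.cong ℕ.suc eq , λ T → begin
      U * c + T * (c + d + T * evalMonic ds T)    ≈⟨ solve 5 (λ U T c d m → U :* c :+ T :* (c :+ d :+ T :* m) := U :* c :+ T :* (c :+ (d :+ T :* m))) refl U T c d (evalMonic ds T) ⟩
      U * c + T * (c + (d + T * evalMonic ds T))  ≈⟨ +-congˡ (*-congˡ (+-congˡ (h T))) ⟩
      U * c + T * (c + (T + U) * evalMonic cs T)  ≈⟨ solve 4 (λ U T c m → U :* c :+ T :* (c :+ (T :+ U) :* m) := (T :+ U) :* (c :+ T :* m)) refl U T c (evalMonic cs T) ⟩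
      (T + U) * (c + T * evalMonic cs T)          ∎

  monic-^ : ∀ U n → ∃ λ cs → length cs ≡ n × (∀ T → evalMonic cs T ≈ (T + U) ^ n)
  monic-^ U ℕ.zero = [] , ≡.refl , λ T → refl
  monic-^ U (ℕ.suc n)
    with cs , ≡.refl , h ← monic-^ U n
    with d , ds , eq , h′ ← monic-*-linear U cs =
    d ∷ ds , ≡.cong ℕ.suc eq , λ T → trans (h′ T) (*-congˡ (h T))

  -- Degree at least two keeps the leading coefficient 1 intact when a linear polynomial is added.
  monic-+-linear : ∀ c d cs → 2 ℕ.≤ length cs → ∃ λ ds → length ds ≡ length cs ×
    (∀ T → evalMonic ds T ≈ evalMonic cs T + (c + d * T))
  monic-+-linear c d (c₀ ∷ c₁ ∷ cs) _ = c₀ + c ∷ c₁ + d ∷ cs , ≡.refl , λ T →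
    solve 6 (λ c d c₀ c₁ T m → c₀ :+ c :+ T :* (c₁ :+ d :+ T :* m) := c₀ :+ T :* (c₁ :+ T :* m) :+ (c :+ d :* T))
      refl c d c₀ c₁ T (evalMonic cs T)
  monic-+-linear c d (_ ∷ []) (s≤s ())

  -- Both T^q - T and (T + 1)^q - 1 - T are monic of degree q and vanish on the
  -- subfield of q elements, so they agree: this is the Frobenius identity.
  module Frobenius {q} (2≤q : 2 ℕ.≤ q) (a : Fin q → Carrier)
    (distinct : ∀ {i j} → i ≢ j → a i - a j # 0#)
    (fixed : ∀ i → a i ^ q ≈ a i) (fixed+1 : ∀ i → (a i + 1#) ^ q ≈ a i + 1#)
    where

    private
      -- Used with `U = 0#`, `c = 0#`, `d = - 1#` and with `U = 1#`, `c = d = - 1#`. The product on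
      -- the right does not depend on these choices, which is what allows the two polynomials to be
      -- compared.
      split : ∀ U c d → (∀ i → (a i + U) ^ q + (c + d * a i) ≈ 0#) →
              ∀ T → (T + U) ^ q + (c + d * T) ≈ ∏.sum (λ i → T - a i)
      split U c d root T
        with cs , ≡.refl , h ← monic-^ U q
        with ds , eq , h′ ← monic-+-linear c d cs 2≤q =
        trans (sym (value T)) (evalMonic≈∏ ds eq a (λ i → trans (value (a i)) (root i)) distinct T)
        where
        value : ∀ T → evalMonic ds T ≈ (T + U) ^ length cs + (c + d * T)
        value T = trans (h′ T) (+-congʳ (h T))

    ∏[T-a]≈T^q-T : ∀ T → ∏.sum (λ i → T - a i) ≈ T ^ q - T
    ∏[T-a]≈T^q-T T = trans (sym (split 0# 0# (- 1#) (λ i → trans (reduce (a i)) (trans (+-congʳ (fixed i)) (-‿inverseʳ (a i)))) T)) (reduce T)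
      where
      reduce : ∀ T → (T + 0#) ^ q + (0# + - 1# * T) ≈ T ^ q - T
      reduce T = +-cong (^-congˡ q (+-identityʳ T))
        (solve 1 (λ T → con (+ 0) :+ :- con (+ 1) :* T := :- T) refl T)

    private
      [T+1]^q : ∀ T → (T + 1#) ^ q ≈ T ^ q + 1#
      [T+1]^q T = begin
        (T + 1#) ^ q                                      ≈⟨ solve 2 (λ x T → x := (x :+ (:- con (+ 1) :+ :- con (+ 1) :* T)) :+ (T :+ con (+ 1))) refl _ T ⟩
        ((T + 1#) ^ q + (- 1# + - 1# * T)) + (T + 1#)     ≈⟨ +-congʳ (split 1# (- 1#) (- 1#) root T) ⟩
        ∏.sum (λ i → T - a i) + (T + 1#)                  ≈⟨ +-congʳ (∏[T-a]≈T^q-T T) ⟩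
        (T ^ q - T) + (T + 1#)                            ≈⟨ solve 2 (λ x T → (x :- T) :+ (T :+ con (+ 1)) := x :+ con (+ 1)) refl _ T ⟩
        T ^ q + 1#                                        ∎
        where
        root : ∀ i → (a i + 1#) ^ q + (- 1# + - 1# * a i) ≈ 0#
        root i = trans (+-congʳ (fixed+1 i))
          (solve 1 (λ x → (x :+ con (+ 1)) :+ (:- con (+ 1) :+ :- con (+ 1) :* x) := con (+ 0)) refl (a i))

      x^q+0^q : ∀ T → T ^ q + 0# ^ q ≈ T ^ q
      x^q+0^q T = trans (+-congˡ (0^n≈0 (ℕₚ.<⇒≤ 2≤q) refl)) (+-identityʳ _)

    -- For `U # 0#`, writing (T + U)^q = U^q (T/U + 1)^q reduces to the case U = 1; for `U ≈ 0#` the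
    -- claim is trivial. The case distinction is made under a double negation.
    [T+U]^q : ∀ T U → (T + U) ^ q ≈ T ^ q + U ^ q
    [T+U]^q T U = ≈-stable λ ≉ → ≉⇒¬¬# {U} {0#}
      (λ U≈0 → ≉ (trans (^-congˡ q (trans (+-congˡ U≈0) (+-identityʳ T)))
                  (trans (sym (x^q+0^q T)) (+-congˡ (sym (^-congˡ q U≈0))))))
      (λ U#0 → ≉ (apart U#0))
      where
      apart : U # 0# → (T + U) ^ q ≈ T ^ q + U ^ q
      apart U#0 = begin
        (T + U) ^ q                     ≈⟨ ^-congˡ q (trans (+-cong (sym ([x/z]*z T U#0)) (sym (*-identityˡ U))) (sym (distribʳ U V 1#))) ⟩
        ((V + 1#) * U) ^ q              ≈⟨ ^-distrib-* (V + 1#) U q ⟩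
        (V + 1#) ^ q * U ^ q            ≈⟨ *-congʳ ([T+1]^q V) ⟩
        (V ^ q + 1#) * U ^ q            ≈⟨ distribʳ _ _ _ ⟩
        V ^ q * U ^ q + 1# * U ^ q      ≈⟨ +-cong (sym (^-distrib-* V U q)) (*-identityˡ _) ⟩
        (V * U) ^ q + U ^ q             ≈⟨ +-congʳ (^-congˡ q ([x/z]*z T U#0)) ⟩
        T ^ q + U ^ q                   ∎
        where V = T / U#0

-- Sums and products indexed by words over a finite alphabet.

module SumProperties (M : CommutativeMonoid 0ℓ 0ℓ) where

  open CommutativeMonoid M
  open MonoidSum M

  sum-single : ∀ {n} (a : Fin n → Carrier) i → (∀ j → j ≢ i → a j ≈ ε) → sum a ≈ a i
  sum-single {ℕ.suc n} a i a≈ε = trans (sum-remove {i = i} a)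
    (trans (∙-congˡ (trans (sum-cong-≋ (λ j → a≈ε _ (Finₚ.punchInᵢ≢i i j))) (sum-replicate-zero n)))
           (identityʳ (a i)))

  sum-cong : ∀ n {a b : Fin n → Carrier} → (∀ i → a i ≈ b i) → sum a ≈ sum b
  sum-cong n a≈b = sum-cong-≋ {n} a≈b

  sum-++ : ∀ m {n} (a : Fin (m ℕ.+ n) → Carrier) →
           sum a ≈ sum (λ i → a (i Fin.↑ˡ n)) ∙ sum (λ j → a (m Fin.↑ʳ j))
  sum-++ ℕ.zero    a = sym (identityˡ _)
  sum-++ (ℕ.suc m) a = trans (∙-congˡ (sum-++ m (a ∘ Fin.suc))) (sym (assoc _ _ _))

  sum-combine : ∀ m {n} (a : Fin (m ℕ.* n) → Carrier) →
                sum a ≈ sum {m} (λ i → sum (λ j → a (Fin.combine i j)))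
  sum-combine ℕ.zero    a = refl
  sum-combine (ℕ.suc m) {n} a = trans (sum-++ n a) (∙-congˡ (sum-combine m (a ∘ (n Fin.↑ʳ_))))

  -- A nested sum, one letter at a time. Unlike a sum over codes in `Fin (q ^ n)`, it can be
  -- regrouped by a chosen letter.
  sumWords : ∀ {q} n → ((Fin n → Fin q) → Carrier) → Carrier
  sumWords     ℕ.zero    g = g (λ ())
  sumWords {q} (ℕ.suc n) g = sum {q} (λ a → sumWords n (λ c → g (a ∷ᵛ c)))

  -- Words are functions, and two codings of a word agree only pointwise, so invariance has to be
  -- demanded of the summand.
  Extensional : ∀ {n q} → ((Fin n → Fin q) → Carrier) → Set
  Extensional g = ∀ {c d} → c ≗ d → g c ≈ g d

  ∷-cong : ∀ {n} {A : Set} (a : A) {c d : Fin n → A} → c ≗ d → (a ∷ᵛ c) ≗ (a ∷ᵛ d)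
  ∷-cong a c≗d Fin.zero    = ≡.refl
  ∷-cong a c≗d (Fin.suc i) = c≗d i

  sumWords-cong : ∀ {q} n {g h : (Fin n → Fin q) → Carrier} → (∀ c → g c ≈ h c) → sumWords n g ≈ sumWords n h
  sumWords-cong     ℕ.zero    g≈h = g≈h _
  sumWords-cong {q} (ℕ.suc n) g≈h = sum-cong-≋ {q} (λ a → sumWords-cong n (λ c → g≈h (a ∷ᵛ c)))

  sum-finToFun : ∀ {q} n (g : (Fin n → Fin q) → Carrier) → Extensional g →
                 sum (λ k → g (finToFun {q} {n} k)) ≈ sumWords n g
  sum-finToFun     ℕ.zero    g ext = trans (identityʳ _) (ext (λ ()))
  sum-finToFun {q} (ℕ.suc n) g ext = trans (sum-combine q (λ k → g (finToFun {q} {ℕ.suc n} k)))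
    (sum-cong-≋ (λ a → trans (sum-cong-≋ (λ k → ext (digits a k)))
                             (sum-finToFun n (λ c → g (a ∷ᵛ c)) (λ c≗d → ext (∷-cong a c≗d)))))
    where
    digits : ∀ a k → finToFun {q} {ℕ.suc n} (Fin.combine a k) ≗ (a ∷ᵛ finToFun {q} {n} k)
    digits a k Fin.zero    = ≡.cong proj₁ (Finₚ.remQuot-combine {q} {q ℕ.^ n} a k)
    digits a k (Fin.suc i) = ≡.cong (λ r → finToFun {q} {n} (proj₂ r) i) (Finₚ.remQuot-combine {q} {q ℕ.^ n} a k)

  snoc : ∀ {n} {A : Set} → (Fin n → A) → A → Fin (ℕ.suc n) → A
  snoc {ℕ.zero}  c b _           = b
  snoc {ℕ.suc n} c b Fin.zero    = c Fin.zero
  snoc {ℕ.suc n} c b (Fin.suc i) = snoc (c ∘ Fin.suc) b i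

  snoc-∷ : ∀ {n} {A : Set} a b (c : Fin n → A) → (a ∷ᵛ snoc c b) ≗ snoc (a ∷ᵛ c) b
  snoc-∷ a b c Fin.zero    = ≡.refl
  snoc-∷ a b c (Fin.suc i) = ≡.refl

  -- The first letter of a word is the constant coefficient of a polynomial and the last letter the
  -- leading one. Interchanging the sums brings the last letter outside, as an induction on the
  -- degree requires.
  sumWords-snoc : ∀ {q} n (g : (Fin (ℕ.suc n) → Fin q) → Carrier) → Extensional g →
                  sumWords (ℕ.suc n) g ≈ sum {q} (λ b → sumWords n (λ c → g (snoc c b)))
  sumWords-snoc {q} ℕ.zero    g ext = sum-cong q λ b → ext {b ∷ᵛ λ ()} {snoc (λ ()) b} λ { Fin.zero → ≡.refl }
  sumWords-snoc {q} (ℕ.suc n) g ext = begin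
    sum {q} (λ a → sumWords (ℕ.suc n) (λ c → g (a ∷ᵛ c)))                 ≈⟨ sum-cong q (λ a → sumWords-snoc n (λ c → g (a ∷ᵛ c)) (λ c≗d → ext (∷-cong a c≗d))) ⟩
    sum {q} (λ a → sum {q} (λ b → sumWords n (λ c → g (a ∷ᵛ snoc c b))))  ≈⟨ ∑-comm {q} {q} _ ⟩
    sum {q} (λ b → sum {q} (λ a → sumWords n (λ c → g (a ∷ᵛ snoc c b))))  ≈⟨ sum-cong q (λ b → sum-cong q (λ a → sumWords-cong n (λ c → ext (snoc-∷ a b c)))) ⟩
    sum {q} (λ b → sumWords (ℕ.suc n) (λ c → g (snoc c b)))              ∎
    where open SetoidReasoning setoid

-- Fermat's theorem in the field of q elements.

module FiniteField (F : HeytingField 0ℓ 0ℓ 0ℓ) {q} (2≤q : 2 ℕ.≤ q)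
  (card : Inverse (≡.setoid (Fin q)) (FieldOps.setoid F)) where

  open FieldOps F
  open FieldProperties F
  open CommutativeRing commutativeRing
    hiding (Carrier; _≈_; _+_; _*_; -_; 0#; 1#; _-_; setoid; ring; rawRing; +-commutativeMonoid; *-commutativeMonoid)
  open Inverse card using (to; from; to-cong; from-cong; strictlyInverseˡ; strictlyInverseʳ)

  _≟_ : ∀ x y → Dec (x ≈ y)
  x ≟ y with from x Finₚ.≟ from y
  ... | yes eq = yes (trans (sym (strictlyInverseˡ x)) (trans (to-cong eq) (strictlyInverseˡ y)))
  ... | no neq = no λ x≈y → neq (from-cong x≈y)

  to-injective : ∀ {i j} → i ≢ j → ¬ (to i ≈ to j)
  to-injective i≢j eq = i≢j (≡.trans (≡.sym (strictlyInverseʳ _)) (≡.trans (from-cong eq) (strictlyInverseʳ _)))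

  private
    -- Replacing zero by 1 lets a product over all of `Fin q` stand for the product of the nonzero
    -- elements, without an enumeration of these.
    nonzeroPart : Carrier → Carrier
    nonzeroPart x with x ≟ 0#
    ... | yes _ = 1#
    ... | no  _ = x

    nonzeroPart-cong : ∀ {x y} → x ≈ y → nonzeroPart x ≈ nonzeroPart y
    nonzeroPart-cong {x} {y} x≈y with x ≟ 0# | y ≟ 0#
    ... | yes _ | yes _ = refl
    ... | yes x≈0 | no y≉0 = contradiction (trans (sym x≈y) x≈0) y≉0
    ... | no x≉0 | yes y≈0 = contradiction (trans x≈y y≈0) x≉0
    ... | no _ | no _ = x≈y

    1≉0 : ¬ (1# ≈ 0#)
    1≉0 eq = #-irrefl eq 1#0

    nonzeroPart≉0 : ∀ x → ¬ (nonzeroPart x ≈ 0#)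
    nonzeroPart≉0 x with x ≟ 0#
    ... | yes _  = 1≉0
    ... | no x≉0 = x≉0

    ∏≉0 : ∀ {n} (a : Fin n → Carrier) → (∀ i → ¬ (a i ≈ 0#)) → ¬ (∏.sum a ≈ 0#)
    ∏≉0 {ℕ.zero}  a a≉0 = 1≉0
    ∏≉0 {ℕ.suc n} a a≉0 = *≉0 (a≉0 Fin.zero) (∏≉0 (a ∘ Fin.suc) (a≉0 ∘ Fin.suc))

    module Scaling (β : Carrier) (β#0 : β # 0#) where

      β⁻¹ : Carrier
      β⁻¹ = 1# / β#0

      β⁻¹β≈1 : β⁻¹ * β ≈ 1#
      β⁻¹β≈1 = [x/z]*z 1# β#0

      cancel : ∀ {x y z} → x * y ≈ 1# → x * to (from (y * to z)) ≈ to z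
      cancel {x} {y} xy≈1 = trans (*-congˡ (strictlyInverseˡ _))
        (trans (sym (*-assoc x y _)) (trans (*-congʳ xy≈1) (*-identityˡ _)))

      scale : Perm.Permutation q q
      scale = Perm.permutation (λ i → from (β * to i)) (λ i → from (β⁻¹ * to i))
        (λ i → ≡.trans (from-cong (cancel (trans (*-comm _ _) β⁻¹β≈1))) (strictlyInverseʳ i))
        (λ i → ≡.trans (from-cong (cancel β⁻¹β≈1)) (strictlyInverseʳ i))

      β-at-0 : Carrier → Carrier
      β-at-0 x with x ≟ 0#
      ... | yes _ = β
      ... | no  _ = 1#

      scaled : ∀ x → nonzeroPart (β * x) * β-at-0 x ≈ β * nonzeroPart x
      scaled x with x ≟ 0# | (β * x) ≟ 0#
      ... | yes _ | yes _ = *-comm _ _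
      ... | yes x≈0 | no βx≉0 = contradiction (trans (*-congˡ x≈0) (zeroʳ β)) βx≉0
      ... | no x≉0 | yes βx≈0 = contradiction βx≈0 (*≉0 (λ β≈0 → #-irrefl β≈0 β#0) x≉0)
      ... | no _ | no _ = *-identityʳ _

      open SumProperties *-commutativeMonoid using (sum-single)
      open SetoidReasoning setoid

      P : Carrier
      P = ∏.sum (nonzeroPart ∘ to)

      ∏β-at-0 : ∏.sum (β-at-0 ∘ to) ≈ β
      ∏β-at-0 = trans (sum-single (β-at-0 ∘ to) (from 0#) elsewhere) at-0
        where
        elsewhere : ∀ i → i ≢ from 0# → β-at-0 (to i) ≈ 1#
        elsewhere i i≢ with to i ≟ 0#
        ... | yes eq = contradiction (≡.trans (≡.sym (strictlyInverseʳ i)) (from-cong eq)) i≢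
        ... | no _   = refl
        at-0 : β-at-0 (to (from 0#)) ≈ β
        at-0 with to (from 0#) ≟ 0#
        ... | yes _ = refl
        ... | no ≉0 = contradiction (strictlyInverseˡ 0#) ≉0

      -- Multiplication by `β` permutes the field and so preserves the product `P` of the nonzero
      -- elements. Each of the q - 1 nonzero elements contributes one `β`; zero contributes the last
      -- one, on both sides, through `β-at-0`.
      βP : β * P ≈ β ^ q * P
      βP = begin
        β * P                                                       ≈⟨ *-comm β P ⟩
        P * β                                                       ≈⟨ *-cong (∏.sum-permute (nonzeroPart ∘ to) scale) (sym ∏β-at-0) ⟩
        ∏.sum (λ i → nonzeroPart (to (from (β * to i)))) * ∏.sum (β-at-0 ∘ to) ≈⟨ *-congʳ (∏.sum-cong-≋ (λ i → nonzeroPart-cong (strictlyInverseˡ (β * to i)))) ⟩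
        ∏.sum (λ i → nonzeroPart (β * to i)) * ∏.sum (β-at-0 ∘ to)  ≈⟨ ∏.∑-distrib-+ (λ i → nonzeroPart (β * to i)) (β-at-0 ∘ to) ⟨
        ∏.sum (λ i → nonzeroPart (β * to i) * β-at-0 (to i))        ≈⟨ ∏.sum-cong-≋ (λ i → scaled (to i)) ⟩
        ∏.sum (λ i → β * nonzeroPart (to i))                        ≈⟨ ∏.∑-distrib-+ (λ _ → β) (nonzeroPart ∘ to) ⟩
        ∏.sum {q} (λ _ → β) * P                                     ≈⟨ *-congʳ (∏.sum-replicate q) ⟩
        β ^ q * P                                                   ∎

  fermat : ∀ β → β ^ q ≈ β
  fermat β with β ≟ 0#
  ... | yes β≈0 = trans (0^n≈0 (ℕₚ.<⇒≤ 2≤q) β≈0) (sym β≈0)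
  -- Being nonzero gives an inverse only under a double negation, which is harmless because the goal
  -- is an equation.
  ... | no  β≉0 = ≈-stable λ ≉ → ≉⇒¬¬# β≉0 λ β#0 → let open Scaling β β#0 in
      ≉⇒¬¬# (∏≉0 (nonzeroPart ∘ to) (nonzeroPart≉0 ∘ to)) λ P#0 →
        ≉ (sym (*-cancelʳ-# P#0 βP))

-- Digits of Laurent series.

module LaurentProperties (F : HeytingField 0ℓ 0ℓ 0ℓ) where

  open Laurent F
  private
    module F = FieldOps F
    module FR = CommutativeRing F.commutativeRing
  open F using (_≈_; 0#; 1#)
  open SumProperties F.+-commutativeMonoid using (sum-single)

  coeff-const-* : ∀ a s k → coeff (const a *K s) k ≈ a F.* coeff s k
  coeff-const-* a s k = FR.trans
    (sum-single {mulLength (const a) s k} (λ j → mulTerm (const a) s k (0ℤ ℤ.+ + toℕ j)) Fin.zero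
      λ { Fin.zero 0≢0 → contradiction ≡.refl 0≢0 ; (Fin.suc j) _ → FR.zeroˡ _ })
    (FR.reflexive (≡.cong (λ i → a F.* coeff s i) (ℤₚ.+-identityʳ k)))

  coeff-x-* : ∀ s k → coeff (xK *K s) k ≈ coeff s (k ℤ.- 1ℤ)
  coeff-x-* s k = lemma _ ≡.refl
    where
    term : ℕ → F.Carrier
    term j = mulTerm xK s k (0ℤ ℤ.+ + j)

    lemma : ∀ n → n ≡ ℤ.∣ k ℤ.- 0ℤ ℤ.- order s ∣ → F.∑< (ℕ.suc n) term ≈ coeff s (k ℤ.- 1ℤ)
    -- The sum has a single term only if k is the order of `s`. Then the term of x^1 is missing, but
    -- k - 1 lies below the order, so both sides vanish.
    lemma ℕ.zero eq = FR.trans (FR.trans (FR.+-identityʳ _) (FR.zeroˡ _))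
      (FR.sym (vanishes s _ (≡.subst (k ℤ.- 1ℤ ℤ.<_) k≡order (ℤₚ.+-monoʳ-< k {ℤ.- 1ℤ} {0ℤ} ℤ.-<+))))
      where
      k≡order : k ℤ.+ 0ℤ ≡ order s
      k≡order = ℤₚ.i-j≡0⇒i≡j (k ℤ.+ 0ℤ) (order s) (ℤₚ.∣i∣≡0⇒i≡0 (≡.sym eq))
    lemma (ℕ.suc n) eq = FR.trans
      (sum-single {ℕ.suc (ℕ.suc n)} (λ j → term (toℕ j)) (Fin.suc Fin.zero) λ
        { Fin.zero _                → FR.zeroˡ _
        ; (Fin.suc Fin.zero) 1≢1    → contradiction ≡.refl 1≢1
        ; (Fin.suc (Fin.suc j)) _   → FR.zeroˡ _ })
      (FR.*-identityˡ _)

  const-+ : ∀ a b → const (a F.+ b) ≈K const a +K const b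
  const-+ a b (+ ℕ.zero)    = FR.refl
  const-+ a b (+ (ℕ.suc n)) = FR.sym (FR.+-identityˡ 0#)
  const-+ a b -[1+ n ]      = FR.sym (FR.+-identityˡ 0#)

  const-* : ∀ a b → const (a F.* b) ≈K const a *K const b
  const-* a b k = FR.trans (lemma k) (FR.sym (coeff-const-* a (const b) k))
    where
    lemma : ∀ k → coeff (const (a F.* b)) k ≈ a F.* coeff (const b) k
    lemma (+ ℕ.zero)    = FR.refl
    lemma (+ (ℕ.suc n)) = FR.sym (FR.zeroʳ a)
    lemma -[1+ n ]      = FR.sym (FR.zeroʳ a)

  const-cong : ∀ {a b} → a ≈ b → const a ≈K const b
  const-cong a≈b (+ ℕ.zero)    = a≈b
  const-cong a≈b (+ (ℕ.suc n)) = FR.refl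
  const-cong a≈b -[1+ n ]      = FR.refl

  const+x* : ∀ t a s → coeff t 0ℤ ≈ a → (∀ n → coeff t (+ ℕ.suc n) ≈ coeff s (+ n)) →
             (∀ n → coeff t -[1+ n ] ≈ 0#) → (∀ n → coeff s -[1+ n ] ≈ 0#) →
             t ≈K const a +K xK *K s
  const+x* t a s t₀ t₊ t₋ s₋ k = FR.trans (lemma k) (FR.+-congˡ (FR.sym (coeff-x-* s k)))
    where
    lemma : ∀ k → coeff t k ≈ coeff (const a) k F.+ coeff s (k ℤ.- 1ℤ)
    lemma (+ ℕ.zero)    = FR.trans t₀ (FR.sym (FR.trans (FR.+-congˡ (s₋ 0)) (FR.+-identityʳ a)))
    lemma (+ (ℕ.suc n)) = FR.trans (t₊ n) (FR.sym (FR.+-identityˡ _))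
    lemma -[1+ n ]      = FR.trans (t₋ n) (FR.sym (FR.trans (FR.+-identityˡ _) (s₋ _)))

  poly-suc : ∀ {n} (c : Fin (ℕ.suc n) → F.Carrier) →
             poly c ≈K const (c Fin.zero) +K xK *K poly (c ∘ Fin.suc)
  poly-suc c = const+x* (poly c) _ (poly (c ∘ Fin.suc)) FR.refl (λ _ → FR.refl) (λ _ → FR.refl) (λ _ → FR.refl)

  -- The map t ↦ (t - t_0) / x, where t_0 is the constant coefficient. It carries the arguments that
  -- proceed digit by digit.
  shift : O → O
  shift t = _∈O {record { coeff = shifted ; order = 0ℤ ; vanishes = shifted-vanishes }}
              (λ i i<0 → shifted-vanishes i (fromℤ-cancel-< i<0))
    where
    shifted : ℤ → F.Carrier
    shifted (+ n)    = coeff (val t) (+ ℕ.suc n)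
    shifted -[1+ n ] = 0#

    shifted-vanishes : ∀ i → i ℤ.< 0ℤ → shifted i ≈ 0#
    shifted-vanishes (+ n)    (ℤ.+<+ ())
    shifted-vanishes -[1+ n ] _ = FR.refl

  O-decompose : ∀ t → val t ≈K const (coeff (val t) 0ℤ) +K xK *K val (shift t)
  O-decompose t = const+x* (val t) _ (val (shift t)) FR.refl (λ _ → FR.refl)
    (λ n → integral t -[1+ n ] (fromℤ-mono-< {j = 0ℤ} ℤ.-<+)) (λ _ → FR.refl)

-- Integer exponents and growth of q^n.

⌜_⌝ : ℕ → ℚ
⌜ n ⌝ = fromℤ (+ n)

⌜⌝-suc : ∀ n → ⌜ ℕ.suc n ⌝ ≡ 1ℚ ℚ.+ ⌜ n ⌝
⌜⌝-suc n = ℚₚ.toℚᵘ-injective (ℚᵘₚ.≃-trans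
  (ℚᵘ.*≡* (≡.trans (ℤₚ.*-identityʳ (+ ℕ.suc n))
    (≡.sym (≡.trans (ℤₚ.*-identityʳ (1ℤ ℤ.+ (+ n ℤ.* 1ℤ))) (≡.cong (λ k → 1ℤ ℤ.+ k) (ℤₚ.*-identityʳ (+ n)))))))
  (ℚᵘₚ.≃-sym (ℚₚ.toℚᵘ-homo-+ 1ℚ ⌜ n ⌝)))

⌜⌝-mono : ∀ {m n} → m ℕ.≤ n → ⌜ m ⌝ ℚ.≤ ⌜ n ⌝
⌜⌝-mono m≤n = ℚ.*≤* (ℤₚ.*-monoʳ-≤-nonNeg 1ℤ (ℤ.+≤+ m≤n))

archimedean : ∀ r → ∃ λ n → r ℚ.≤ ⌜ n ⌝
archimedean (ℚ.mkℚ (+ m) d _) = m , ℚ.*≤* (ℤₚ.*-monoˡ-≤-nonNeg (+ m) (ℤ.+≤+ (s≤s z≤n)))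
archimedean (ℚ.mkℚ -[1+ m ] d _) = 0 , ℚ.*≤* ℤ.-≤+

n<q^n : ∀ {q} → 2 ℕ.≤ q → ∀ n → n ℕ.< q ℕ.^ n
n<q^n 2≤q ℕ.zero = s≤s z≤n
n<q^n {q} 2≤q (ℕ.suc n) = begin
  2 ℕ.+ n                ≤⟨ ℕₚ.+-mono-≤ {1} (ℕₚ.≤-trans (s≤s z≤n) (n<q^n 2≤q n)) (n<q^n 2≤q n) ⟩
  q ℕ.^ n ℕ.+ q ℕ.^ n    ≡⟨ ≡.cong (q ℕ.^ n ℕ.+_) (ℕₚ.+-identityʳ _) ⟨
  2 ℕ.* q ℕ.^ n          ≤⟨ ℕₚ.*-monoˡ-≤ (q ℕ.^ n) 2≤q ⟩
  q ℕ.* q ℕ.^ n          ∎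
  where open ℕₚ.≤-Reasoning

-- One n pays for the factor q^n in the bound of f_n(t) / t; the other leaves q^(-n) as a bound for
-- the n-th term of the series of C_t(z) / t.
2n≤q^n : ∀ {q} → 2 ℕ.≤ q → ∀ n → n ℕ.+ n ℕ.≤ q ℕ.^ n
2n≤q^n 2≤q ℕ.zero = z≤n
2n≤q^n {q} 2≤q (ℕ.suc n) = begin
  ℕ.suc n ℕ.+ ℕ.suc n    ≡⟨ ≡.cong (ℕ.suc n ℕ.+_) (ℕₚ.+-identityʳ _) ⟨
  2 ℕ.* ℕ.suc n          ≤⟨ ℕₚ.*-mono-≤ 2≤q (n<q^n 2≤q n) ⟩
  q ℕ.* q ℕ.^ n          ∎
  where open ℕₚ.≤-Reasoning

-- Estimates and convergent series in the completed algebraic closure.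

module AbsoluteValues
  {p γ : ℕ} (p-prime : Prime p) (γ≥1 : 1 ℕ.≤ γ)
  (F : HeytingField 0ℓ 0ℓ 0ℓ)
  (card : Inverse (≡.setoid (Fin (p ℕ.^ γ))) (FieldOps.setoid F))
  (K̄c : CompletedAlgebraicClosure F)
  where

  open Carlitz p-prime γ≥1 F card K̄c public
  open Laurent F public using (_≈K_; _+K_; _*K_; -K_; -O_; coeff; integral)
  open LaurentProperties F public
  module K̄ = CompletedAlgebraicClosure K̄c
  module F = FieldOps F
  module FR = CommutativeRing F.commutativeRing
  module H₁ = IsRingHomomorphism K̄.ι₁-homomorphism
  module H₂ = IsRingHomomorphism K̄.ι₂-homomorphism
  open CommutativeRing commutativeRing public
    hiding (Carrier; _≈_; _+_; _*_; -_; 0#; 1#; _-_; setoid; ring; rawRing; +-commutativeMonoid; *-commutativeMonoid)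
  open FieldProperties K̄.completion public
  open IntegerSolver commutativeRing public
  open RingProperties ring public using (-0#≈0#; -1*x≈-x)
  open Exp semiring public using (^-congˡ; ^-assocʳ)
  open CommExp commutativeSemiring public using (^-distrib-*)
  open SetoidReasoning setoid

  2≤q : 2 ℕ.≤ q
  2≤q = ℕₚ.≤-trans (ℕ.nonTrivial⇒n>1 p {{prime⇒nonTrivial p-prime}}) (p≤p^ γ≥1)
    where
    instance
      p≢0 : ℕ.NonZero p
      p≢0 = ℕ.>-nonZero (ℕₚ.≤-trans (s≤s z≤n) (ℕ.nonTrivial⇒n>1 p {{prime⇒nonTrivial p-prime}}))
    p≤p^ : ∀ {γ} → 1 ℕ.≤ γ → p ℕ.≤ p ℕ.^ γ
    p≤p^ (s≤s {n = n} _) = ℕₚ.m≤m*n p (p ℕ.^ n) {{ℕₚ.m^n≢0 p n}}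

  ι-cong : ∀ {a b} → a ≈K b → ι a ≈ ι b
  ι-cong a≈b = H₂.⟦⟧-cong (H₁.⟦⟧-cong a≈b)

  ι-+ : ∀ a b → ι (a +K b) ≈ ι a + ι b
  ι-+ a b = trans (H₂.⟦⟧-cong (H₁.+-homo a b)) (H₂.+-homo _ _)

  ι-* : ∀ a b → ι (a *K b) ≈ ι a * ι b
  ι-* a b = trans (H₂.⟦⟧-cong (H₁.*-homo a b)) (H₂.*-homo _ _)

  ι-neg : ∀ a → ι (-K a) ≈ - ι a
  ι-neg a = trans (H₂.⟦⟧-cong (H₁.-‿homo a)) (H₂.-‿homo _)

  ι-sub : ∀ a b → ι (a -K b) ≈ ι a - ι b
  ι-sub a b = trans (ι-+ a (-K b)) (+-congˡ (ι-neg b))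

  κ : F.Carrier → Carrier
  κ α = ι (const α)

  κ-0 : κ F.0# ≈ 0#
  κ-0 = trans (H₂.⟦⟧-cong H₁.0#-homo) H₂.0#-homo

  κ-1 : κ F.1# ≈ 1#
  κ-1 = trans (H₂.⟦⟧-cong H₁.1#-homo) H₂.1#-homo

  κ-+ : ∀ α β → κ (α F.+ β) ≈ κ α + κ β
  κ-+ α β = trans (ι-cong (const-+ α β)) (ι-+ _ _)

  κ-* : ∀ α β → κ (α F.* β) ≈ κ α * κ β
  κ-* α β = trans (ι-cong (const-* α β)) (ι-* _ _)

  ∣ι∣≤ : ∀ {z r} → ∣ z ∣K≤q^- r → ∣ ι z ∣≤q^- r
  ∣ι∣≤ h = Equivalence.to (K̄.ι₂-isometry _ _) (Equivalence.to (K̄.ι₁-isometry _ _) h)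

  ∣ι∣≤⁻¹ : ∀ {z r} → ∣ ι z ∣≤q^- r → ∣ z ∣K≤q^- r
  ∣ι∣≤⁻¹ h = Equivalence.from (K̄.ι₁-isometry _ _) (Equivalence.from (K̄.ι₂-isometry _ _) h)

  *-≤ : ∀ {z w r s} → ∣ z ∣≤q^- r → ∣ w ∣≤q^- s → ∣ z * w ∣≤q^- (r ℚ.+ s)
  *-≤ {r = r} {s} zr ws = Equivalence.from (multiplicative _ _ _) (r , s , ≡.refl , zr , ws)

  ∣0∣≤ : ∀ r → ∣ 0# ∣≤q^- r
  ∣0∣≤ r = resp κ-0 (∣ι∣≤ {const F.0#} λ where
    (+ ℕ.zero)    _ → FR.refl
    (+ (ℕ.suc n)) _ → FR.refl
    -[1+ n ]      _ → FR.refl)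

  ∣O∣≤1 : ∀ (t : O) → ∣ ιO t ∣≤q^- 0ℚ
  ∣O∣≤1 t = ∣ι∣≤ (integral t)

  ∣κ∣≤1 : ∀ α → ∣ κ α ∣≤q^- 0ℚ
  ∣κ∣≤1 α = ∣O∣≤1 (constO α)

  ∣1∣≤1 : ∣ 1# ∣≤q^- 0ℚ
  ∣1∣≤1 = resp κ-1 (∣κ∣≤1 F.1#)

  ≤1-* : ∀ {z w r} → ∣ z ∣≤q^- 0ℚ → ∣ w ∣≤q^- r → ∣ z * w ∣≤q^- r
  ≤1-* {r = r} z≤1 wr = ≡.subst (∣ _ ∣≤q^-_) (ℚₚ.+-identityˡ r) (*-≤ z≤1 wr)

  *-≤1 : ∀ {z w r} → ∣ z ∣≤q^- r → ∣ w ∣≤q^- 0ℚ → ∣ z * w ∣≤q^- r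
  *-≤1 {r = r} zr w≤1 = ≡.subst (∣ _ ∣≤q^-_) (ℚₚ.+-identityʳ r) (*-≤ zr w≤1)

  neg-≤ : ∀ {z r} → ∣ z ∣≤q^- r → ∣ - z ∣≤q^- r
  neg-≤ {z} zr = resp (-1*x≈-x z) (≤1-* (resp (trans (ι-neg _) (-‿cong κ-1)) (∣O∣≤1 (-O (constO F.1#)))) zr)

  sub-≤ : ∀ {z w r} → ∣ z ∣≤q^- r → ∣ w ∣≤q^- r → ∣ z - w ∣≤q^- r
  sub-≤ zr wr = ultrametric zr (neg-≤ wr)

  swap-≤ : ∀ {z w r} → ∣ z - w ∣≤q^- r → ∣ w - z ∣≤q^- r
  swap-≤ {z} {w} h = resp (solve 2 (λ z w → :- (z :- w) := w :- z) refl z w) (neg-≤ h)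

  via-≤ : ∀ {z v r} w → ∣ z - w ∣≤q^- r → ∣ w - v ∣≤q^- r → ∣ z - v ∣≤q^- r
  via-≤ {z} {v} w h h′ = resp (solve 3 (λ z w v → (z :- w) :+ (w :- v) := z :- v) refl z w v) (ultrametric h h′)

  ^-≤1 : ∀ {z} n → ∣ z ∣≤q^- 0ℚ → ∣ z ^ n ∣≤q^- 0ℚ
  ^-≤1 ℕ.zero    h = ∣1∣≤1
  ^-≤1 (ℕ.suc n) h = ≤1-* h (^-≤1 n h)

  ^-≤⌜⌝ : ∀ {z} n → ∣ z ∣≤q^- 1ℚ → ∣ z ^ n ∣≤q^- ⌜ n ⌝
  ^-≤⌜⌝ ℕ.zero    h = ∣1∣≤1
  ^-≤⌜⌝ {z} (ℕ.suc n) h = ≡.subst (∣ z ^ ℕ.suc n ∣≤q^-_) (≡.sym (⌜⌝-suc n)) (*-≤ h (^-≤⌜⌝ n h))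

  0≤⌜⌝ : ∀ n → 0ℚ ℚ.≤ ⌜ n ⌝
  0≤⌜⌝ n = ⌜⌝-mono {0} {n} z≤n

  ^-≤ : ∀ {z r} n → 1 ℕ.≤ n → 0ℚ ℚ.≤ r → ∣ z ∣≤q^- r → ∣ z ^ n ∣≤q^- r
  ^-≤ (ℕ.suc n) _ 0≤r h = *-≤1 h (^-≤1 n (antitone 0≤r h))

  -- Were z apart from zero, `positive` would name a bound that z violates, and some integer
  -- exponent lies beyond it. This turns estimates into equations.
  ≤⇒≈0 : ∀ {z} → (∀ n → ∣ z ∣≤q^- ⌜ n ⌝) → z ≈ 0#
  ≤⇒≈0 {z} h = proj₁ (tight z 0#) λ z#0 →
    let r , ≰ = Equivalence.to (positive z) z#0
        n , r≤n = archimedean r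
    in ≰ (antitone r≤n (h n))

  ≤⇒≈ : ∀ {z w} → (∀ n → ∣ z - w ∣≤q^- ⌜ n ⌝) → z ≈ w
  ≤⇒≈ {z} {w} h = trans (solve 2 (λ z w → z := (z :- w) :+ w) refl z w)
    (trans (+-congʳ (≤⇒≈0 h)) (+-identityˡ w))

  ≈⇒≤ : ∀ {z w} r → z ≈ w → ∣ z - w ∣≤q^- r
  ≈⇒≤ {z} {w} r z≈w = resp (sym (trans (+-congʳ z≈w) (-‿inverseʳ w))) (∣0∣≤ r)

  ∣X∣≤q⁻¹ : ∣ X ∣≤q^- 1ℚ
  ∣X∣≤q⁻¹ = ∣ι∣≤ {xK} λ i i<1 → xK-coeff i (fromℤ-cancel-< i<1)
    where
    xK-coeff : ∀ i → i ℤ.< 1ℤ → coeff xK i F.≈ F.0#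
    xK-coeff (+ ℕ.zero)    _ = FR.refl
    xK-coeff (+ (ℕ.suc n)) (ℤ.+<+ (s≤s ()))
    xK-coeff -[1+ n ]      _ = FR.refl

  ∣X∣≰ : ∀ {r} → 1ℚ ℚ.< r → ¬ (∣ X ∣≤q^- r)
  ∣X∣≰ 1<r h = F.#-irrefl (∣ι∣≤⁻¹ {xK} h 1ℤ 1<r) F.1#0

  -- Absolute values are not numbers that could be inverted. Instead `multiplicative`, applied to 1
  -- = (1/[k+1]) [k+1], yields r + s = 0 with |1/[k+1]| ≤ q^(-r) and |[k+1]| ≤ q^(-s). If s > 1,
  -- then x = x^(q^(k+1)) - [k+1] would have exponent at least min(s, 2) > 1, which is impossible;
  -- so s ≤ 1 and r ≥ -1.
  ∣1/[]∣≤q : ∀ k → ∣ 1# / []#0 k ∣≤q^- (ℚ.- 1ℚ)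
  ∣1/[]∣≤q k = bound (Equivalence.to (multiplicative _ _ _) (resp (sym ([x/z]*z 1# ([]#0 k))) ∣1∣≤1))
    where
    2≤q^ : 2 ℕ.≤ q ℕ.^ ℕ.suc k
    2≤q^ = ℕₚ.≤-trans (s≤s (s≤s z≤n)) (n<q^n 2≤q (ℕ.suc k))
    ∣X∣≤ : ∀ {s t} → ∣ [ ℕ.suc k ] ∣≤q^- s → t ℚ.≤ s → t ℚ.≤ ⌜ 2 ⌝ → ∣ X ∣≤q^- t
    ∣X∣≤ hs t≤s t≤2 = resp (solve 2 (λ y x → y :- (y :- x) := x) refl (X ^ (q ℕ.^ ℕ.suc k)) X)
      (sub-≤ (antitone t≤2 (antitone (⌜⌝-mono 2≤q^) (^-≤⌜⌝ _ ∣X∣≤q⁻¹))) (antitone t≤s hs))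
    [k]≤ : ∀ {s} → ¬ (s ℚ.≤ 1ℚ) → ¬ (∣ [ ℕ.suc k ] ∣≤q^- s)
    [k]≤ {s} s≰1 hs with ℚₚ.≤-total s ⌜ 2 ⌝
    ... | inj₁ s≤2 = ∣X∣≰ (ℚₚ.≰⇒> s≰1) (∣X∣≤ hs ℚₚ.≤-refl s≤2)
    ... | inj₂ 2≤s = ∣X∣≰ {⌜ 2 ⌝} (fromℤ-mono-< {1ℤ} (ℤ.+<+ (s≤s (s≤s z≤n)))) (∣X∣≤ hs 2≤s ℚₚ.≤-refl)

    bound : ∀ {y} → (∃₂ λ r s → r ℚ.+ s ≡ 0ℚ × ∣ y ∣≤q^- r × ∣ [ ℕ.suc k ] ∣≤q^- s) → ∣ y ∣≤q^- (ℚ.- 1ℚ)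
    bound (r , s , r+s≡0 , hr , hs) with s ℚₚ.≤? 1ℚ
    ... | no  s≰1 = contradiction hs ([k]≤ s≰1)
    ... | yes s≤1 = antitone (≡.subst (ℚ.- 1ℚ ℚ.≤_) (≡.sym (inverseˡ-unique r s r+s≡0)) (ℚₚ.neg-antimono-≤ s≤1)) hr
      where open GroupProperties ℚₚ.+-0-group using (inverseˡ-unique)

  ∑<-≤ : ∀ {r} n (a : ℕ → Carrier) → (∀ i → ∣ a i ∣≤q^- r) → ∣ ∑< n a ∣≤q^- r
  ∑<-≤ ℕ.zero    a h = ∣0∣≤ _
  ∑<-≤ (ℕ.suc n) a h = ultrametric (h 0) (∑<-≤ n (a ∘ ℕ.suc) (h ∘ ℕ.suc))

  -- Convergence at a prescribed rate. For a family of series indexed by t this is uniform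
  -- convergence, and limits can be compared through partial sums of the same length.
  record SumsTo (a : ℕ → Carrier) (l : Carrier) : Set where
    constructor sumsTo
    field
      remainder : ∀ n → ∣ ∑< n a - l ∣≤q^- ⌜ n ⌝
  open SumsTo public

  ∑<-tail : ∀ (a : ℕ → Carrier) → (∀ i → ∣ a i ∣≤q^- ⌜ i ⌝) → ∀ n k → ∣ ∑< (k ℕ.+ n) a - ∑< n a ∣≤q^- ⌜ n ⌝
  ∑<-tail a h n ℕ.zero    = ≈⇒≤ _ refl
  ∑<-tail a h n (ℕ.suc k) = via-≤ (∑< (k ℕ.+ n) a)
    (resp (trans (solve 2 (λ s x → x := (s :+ x) :- s) refl (∑< (k ℕ.+ n) a) _) (+-congʳ (sym (∑<-last (k ℕ.+ n) a))))
      (antitone (⌜⌝-mono (ℕₚ.m≤n+m n k)) (h (k ℕ.+ n))))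
    (∑<-tail a h n k)

  sum-exists : ∀ a → (∀ i → ∣ a i ∣≤q^- ⌜ i ⌝) → ∃ (SumsTo a)
  sum-exists a h = proj₁ limit , sumsTo λ n → tail n (proj₂ limit ⌜ n ⌝)
    where
    beyond : ∀ {n m} → n ℕ.≤ m → ∣ ∑< m a - ∑< n a ∣≤q^- ⌜ n ⌝
    beyond {n} {m} n≤m = ≡.subst (λ k → ∣ ∑< k a - ∑< n a ∣≤q^- ⌜ n ⌝) (ℕₚ.m∸n+n≡m n≤m) (∑<-tail a h n (m ℕ.∸ n))

    cauchy : Cauchy (λ n → ∑< n a)
    cauchy r with n , r≤n ← archimedean r = n , λ i j n≤i n≤j →
      antitone r≤n (via-≤ (∑< n a) (beyond n≤i) (swap-≤ (beyond n≤j)))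

    limit : ∃ λ l → Limit (λ n → ∑< n a) l
    limit = K̄.complete (λ n → ∑< n a) cauchy

    tail : ∀ n → ∃ (λ N → ∀ m → N ℕ.≤ m → ∣ ∑< m a - proj₁ limit ∣≤q^- ⌜ n ⌝) →
           ∣ ∑< n a - proj₁ limit ∣≤q^- ⌜ n ⌝
    -- `N + n` is beyond both N and n, so the ultrametric inequality passes from the n-th partial
    -- sum to the limit without loss.
    tail n (N , h′) = via-≤ (∑< (N ℕ.+ n) a) (swap-≤ (beyond (ℕₚ.m≤n+m n N))) (h′ (N ℕ.+ n) (ℕₚ.m≤m+n N n))

  SumsTo⇒HasSum : ∀ {a l} → SumsTo a l → HasSum a l
  SumsTo⇒HasSum al r with N , r≤N ← archimedean r =
    N , λ n N≤n → antitone (ℚₚ.≤-trans r≤N (⌜⌝-mono N≤n)) (remainder al n)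

-- F_q-linear maps and the recursion for the Carlitz polynomials.

module CarlitzPolynomials
  {p γ : ℕ} (p-prime : Prime p) (γ≥1 : 1 ℕ.≤ γ)
  (F : HeytingField 0ℓ 0ℓ 0ℓ)
  (card : Inverse (≡.setoid (Fin (p ℕ.^ γ))) (FieldOps.setoid F))
  (K̄c : CompletedAlgebraicClosure F)
  where

  open AbsoluteValues p-prime γ≥1 F card K̄c public
  open SetoidReasoning setoid
  module Fq = FiniteField F 2≤q card

  el : Fin q → F.Carrier
  el = Inverse.to card

  κ-cong : ∀ {α β} → α F.≈ β → κ α ≈ κ β
  κ-cong α≈β = ι-cong (const-cong α≈β)

  κ-^q : ∀ α → κ α ^ q ≈ κ α
  κ-^q α = trans (sym (κ-^ q)) (κ-cong (Fq.fermat α))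
    where
    κ-^ : ∀ n → κ (α F.^ n) ≈ κ α ^ n
    κ-^ ℕ.zero    = κ-1
    κ-^ (ℕ.suc n) = trans (κ-* α (α F.^ n)) (*-congˡ (κ-^ n))

  -- If the difference had absolute value at most 1/q, isometry would force its constant coefficient
  -- to vanish. So `positive` upgrades inequality of the constants to apartness.
  κ-distinct : ∀ {i j} → i ≢ j → κ (el i) - κ (el j) # 0#
  κ-distinct {i} {j} i≢j = Equivalence.from (positive _) (1ℚ , λ h → Fq.to-injective i≢j
    (RingProperties.x∙y⁻¹≈ε⇒x≈y F.ring (el i) (el j)
      (∣ι∣≤⁻¹ {const (el i) -K const (el j)} (resp (sym (ι-sub _ _)) h) 0ℤ (fromℤ-mono-< {0ℤ} {1ℤ} (ℤ.+<+ (s≤s z≤n))))))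

  private
    κ+1 : ∀ α → κ α + 1# ≈ κ (α F.+ F.1#)
    κ+1 α = sym (trans (κ-+ α F.1#) (+-congˡ κ-1))

    module Frob = Frobenius 2≤q (κ ∘ el) κ-distinct (κ-^q ∘ el)
      (λ i → trans (^-congˡ q (κ+1 (el i))) (trans (κ-^q _) (sym (κ+1 (el i)))))

  ∏[T-κ] : ∀ T → ∏.sum (λ i → T - κ (el i)) ≈ T ^ q - T
  ∏[T-κ] = Frob.∏[T-a]≈T^q-T

  record IsFLinear (φ : Carrier → Carrier) : Set where
    field
      φ-cong : ∀ {T U} → T ≈ U → φ T ≈ φ U
      φ-+    : ∀ T U → φ (T + U) ≈ φ T + φ U
      φ-κ    : ∀ α T → φ (κ α * T) ≈ κ α * φ T

    φ-sub : ∀ T U → φ (T - U) ≈ φ T - φ U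
    φ-sub T U = begin
      φ (T - U)                 ≈⟨ solve 2 (λ x y → x := (x :+ y) :- y) refl (φ (T - U)) (φ U) ⟩
      (φ (T - U) + φ U) - φ U   ≈⟨ +-congʳ (φ-+ (T - U) U) ⟨
      φ ((T - U) + U) - φ U     ≈⟨ +-congʳ (φ-cong (solve 2 (λ x y → (x :- y) :+ y := x) refl T U)) ⟩
      φ T - φ U                 ∎

    φ-0 : φ 0# ≈ 0#
    φ-0 = begin
      φ 0#               ≈⟨ φ-cong (-‿inverseʳ 0#) ⟨
      φ (0# - 0#)        ≈⟨ φ-sub 0# 0# ⟩
      φ 0# - φ 0#        ≈⟨ -‿inverseʳ (φ 0#) ⟩
      0#                 ∎

  open IsFLinear

  id-linear : IsFLinear (λ T → T)
  id-linear = record { φ-cong = λ eq → eq ; φ-+ = λ T U → refl ; φ-κ = λ α T → refl }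

  ^q-linear : ∀ {φ} → IsFLinear φ → IsFLinear (λ T → φ T ^ q)
  ^q-linear l = record
    { φ-cong = λ eq → ^-congˡ q (φ-cong l eq)
    ; φ-+    = λ T U → trans (^-congˡ q (φ-+ l T U)) (Frob.[T+U]^q _ _)
    ; φ-κ    = λ α T → trans (^-congˡ q (φ-κ l α T)) (trans (^-distrib-* (κ α) _ q) (*-congʳ (κ-^q α)))
    }

  sub-linear : ∀ {φ ψ} → IsFLinear φ → IsFLinear ψ → IsFLinear (λ T → φ T - ψ T)
  sub-linear l m = record
    { φ-cong = λ eq → +-cong (φ-cong l eq) (-‿cong (φ-cong m eq))
    ; φ-+    = λ T U → trans (+-cong (φ-+ l T U) (-‿cong (φ-+ m T U)))
                 (solve 4 (λ a b c d → (a :+ b) :- (c :+ d) := (a :- c) :+ (b :- d)) refl _ _ _ _)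
    ; φ-κ    = λ α T → trans (+-cong (φ-κ l α T) (-‿cong (φ-κ m α T)))
                 (solve 3 (λ a b c → a :* b :- a :* c := a :* (b :- c)) refl _ _ _)
    }

  *-linear : ∀ {φ} c → IsFLinear φ → IsFLinear (λ T → φ T * c)
  *-linear c l = record
    { φ-cong = λ eq → *-congʳ (φ-cong l eq)
    ; φ-+    = λ T U → trans (*-congʳ (φ-+ l T U)) (distribʳ c _ _)
    ; φ-κ    = λ α T → trans (*-congʳ (φ-κ l α T)) (*-assoc (κ α) _ c)
    }

  cong-linear : ∀ {φ ψ} → (∀ T → φ T ≈ ψ T) → IsFLinear φ → IsFLinear ψ
  cong-linear eq l = record
    { φ-cong = λ T≈U → trans (sym (eq _)) (trans (φ-cong l T≈U) (eq _))
    ; φ-+    = λ T U → trans (sym (eq _)) (trans (φ-+ l T U) (+-cong (eq T) (eq U)))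
    ; φ-κ    = λ α T → trans (sym (eq _)) (trans (φ-κ l α T) (*-congˡ (eq T)))
    }

  ^q-sub : ∀ T U → (T - U) ^ q ≈ T ^ q - U ^ q
  ^q-sub = φ-sub (^q-linear id-linear)

  ^q-+ : ∀ T U → (T + U) ^ q ≈ T ^ q + U ^ q
  ^q-+ = φ-+ (^q-linear id-linear)

  0^q : 0# ^ q ≈ 0#
  0^q = φ-0 (^q-linear id-linear)

  1^n : ∀ n → 1# ^ n ≈ 1#
  1^n ℕ.zero    = refl
  1^n (ℕ.suc n) = trans (*-identityˡ _) (1^n n)

  ^q^suc : ∀ T n → T ^ (q ℕ.^ ℕ.suc n) ≈ (T ^ (q ℕ.^ n)) ^ q
  ^q^suc T n = trans (reflexive (≡.cong (T ^_) (ℕₚ.*-comm q (q ℕ.^ n)))) (sym (^-assocʳ T (q ℕ.^ n) q))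

  ^q^n-linear : ∀ n → IsFLinear (λ T → T ^ (q ℕ.^ n))
  ^q^n-linear ℕ.zero    = cong-linear (λ T → sym (*-identityʳ T)) id-linear
  ^q^n-linear (ℕ.suc n) = cong-linear (λ T → sym (^q^suc T n)) (^q-linear (^q^n-linear n))

  -- The normalized Carlitz polynomial fᵢ as a function on the whole field.
  f̂ : ℕ → Carrier → Carrier
  f̂ ℕ.zero    T = T
  f̂ (ℕ.suc i) T = (f̂ i T ^ q - f̂ i T) / []#0 i

  f̂-linear : ∀ i → IsFLinear (f̂ i)
  f̂-linear ℕ.zero    = id-linear
  f̂-linear (ℕ.suc i) = *-linear _ (sub-linear (^q-linear (f̂-linear i)) (f̂-linear i))

  f̂-suc : ∀ i T → f̂ (ℕ.suc i) T * [ ℕ.suc i ] ≈ f̂ i T ^ q - f̂ i T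
  f̂-suc i T = [x/z]*z _ ([]#0 i)

  []-suc : ∀ i → [ ℕ.suc i ] ≈ [ i ] ^ q + (X ^ q - X)
  []-suc i = begin
    X ^ (q ℕ.^ ℕ.suc i) - X                     ≈⟨ +-congʳ (^q^suc X i) ⟩
    (X ^ (q ℕ.^ i)) ^ q - X                     ≈⟨ solve 3 (λ a b c → a :- c := (a :- b) :+ (b :- c)) refl _ (X ^ q) X ⟩
    ((X ^ (q ℕ.^ i)) ^ q - X ^ q) + (X ^ q - X) ≈⟨ +-congʳ (^q-sub _ X) ⟨
    [ i ] ^ q + (X ^ q - X)                     ∎

  [0]≈0 : [ 0 ] ≈ 0#
  [0]≈0 = trans (+-congʳ (*-identityʳ X)) (-‿inverseʳ X)

  -- fᵢ (x t) - x fᵢ (t)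
  Δf̂ : ℕ → Carrier → Carrier
  Δf̂ ℕ.zero    T = 0#
  Δf̂ (ℕ.suc i) T = f̂ i T ^ q

  -- For positive index this is the q-th power of the recursion `f̂-suc`; for index 0 both sides
  -- vanish because [0] = 0. The common form lets the induction in `f̂-X*` treat both alike.
  Δf̂-^q : ∀ i T → Δf̂ i T ^ q - Δf̂ i T ≈ [ i ] ^ q * f̂ i T ^ q
  Δf̂-^q ℕ.zero T = begin
    0# ^ q - 0#        ≈⟨ +-congʳ 0^q ⟩
    0# - 0#            ≈⟨ -‿inverseʳ 0# ⟩
    0#                 ≈⟨ zeroˡ _ ⟨
    0# * T ^ q         ≈⟨ *-congʳ (trans (^-congˡ q [0]≈0) 0^q) ⟨
    [ 0 ] ^ q * T ^ q  ∎
  Δf̂-^q (ℕ.suc i) T = begin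
    (f̂ i T ^ q) ^ q - f̂ i T ^ q                 ≈⟨ ^q-sub _ _ ⟨
    (f̂ i T ^ q - f̂ i T) ^ q                     ≈⟨ ^-congˡ q (f̂-suc i T) ⟨
    (f̂ (ℕ.suc i) T * [ ℕ.suc i ]) ^ q           ≈⟨ ^-congˡ q (*-comm _ _) ⟩
    ([ ℕ.suc i ] * f̂ (ℕ.suc i) T) ^ q           ≈⟨ ^-distrib-* [ ℕ.suc i ] _ q ⟩
    [ ℕ.suc i ] ^ q * f̂ (ℕ.suc i) T ^ q         ∎

  -- Apply Y ↦ Y^q - Y to the formula for i. The terms in f_i(T)^q combine because [i]^q + x^q - x =
  -- [i+1], and [i+1] is cancelled at the end.
  f̂-X* : ∀ i T → f̂ i (X * T) ≈ X * f̂ i T + Δf̂ i T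
  f̂-X* ℕ.zero    T = sym (+-identityʳ _)
  f̂-X* (ℕ.suc i) T = *-cancelʳ-# ([]#0 i) (begin
    f̂ (ℕ.suc i) (X * T) * k                     ≈⟨ f̂-suc i (X * T) ⟩
    f̂ i (X * T) ^ q - f̂ i (X * T)               ≈⟨ +-cong (^-congˡ q (f̂-X* i T)) (-‿cong (f̂-X* i T)) ⟩
    (X * a + δ) ^ q - (X * a + δ)               ≈⟨ +-congʳ (trans (^q-+ (X * a) δ) (+-congʳ (^-distrib-* X a q))) ⟩
    (X ^ q * a ^ q + δ ^ q) - (X * a + δ)       ≈⟨ solve 6 (λ Y b e x a d → (Y :* b :+ e) :- (x :* a :+ d) := (Y :* b :- x :* a) :+ (e :- d)) refl (X ^ q) (a ^ q) (δ ^ q) X a δ ⟩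
    (X ^ q * a ^ q - X * a) + (δ ^ q - δ)       ≈⟨ +-congˡ (Δf̂-^q i T) ⟩
    (X ^ q * a ^ q - X * a) + [ i ] ^ q * a ^ q ≈⟨ solve 5 (λ Y b x a j → (Y :* b :- x :* a) :+ j :* b := x :* (b :- a) :+ b :* (j :+ (Y :- x))) refl (X ^ q) (a ^ q) X a ([ i ] ^ q) ⟩
    X * (a ^ q - a) + a ^ q * ([ i ] ^ q + (X ^ q - X)) ≈⟨ +-cong (*-congˡ (f̂-suc i T)) (*-congˡ ([]-suc i)) ⟨
    X * (f̂ (ℕ.suc i) T * k) + a ^ q * k         ≈⟨ solve 4 (λ x u k b → x :* (u :* k) :+ b :* k := (x :* u :+ b) :* k) refl X _ k (a ^ q) ⟩
    (X * f̂ (ℕ.suc i) T + a ^ q) * k             ∎)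
    where
    k a δ : Carrier
    k = [ ℕ.suc i ]
    a = f̂ i T
    δ = Δf̂ i T

  f̂-fixed : ∀ i {T} → f̂ i T ^ q ≈ f̂ i T → f̂ (ℕ.suc i) T ≈ 0#
  f̂-fixed i eq = trans (*-congʳ (trans (+-congʳ eq) (-‿inverseʳ _))) (zeroˡ _)

  -- Since f_i(x^i) = 1 is fixed by the q-th power, f_(i+1) vanishes at x^i, and in f_(i+1)(x x^i)
  -- only f_i(x^i)^q = 1 survives.
  f̂-X^ : ∀ i → f̂ i (X ^ i) ≈ 1#
  f̂-X^ ℕ.zero    = refl
  f̂-X^ (ℕ.suc i) = begin
    f̂ (ℕ.suc i) (X * X ^ i)                       ≈⟨ f̂-X* (ℕ.suc i) (X ^ i) ⟩
    X * f̂ (ℕ.suc i) (X ^ i) + f̂ i (X ^ i) ^ q     ≈⟨ +-cong (trans (*-congˡ (f̂-fixed i (trans 1^q (sym (f̂-X^ i))))) (zeroʳ X)) 1^q ⟩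
    0# + 1#                                       ≈⟨ +-identityˡ 1# ⟩
    1#                                            ∎
    where
    1^q : f̂ i (X ^ i) ^ q ≈ 1#
    1^q = trans (^-congˡ q (f̂-X^ i)) (1^n q)

  f̂-suc-κ : ∀ i α → f̂ (ℕ.suc i) (κ α) ≈ 0#
  f̂-suc-κ ℕ.zero    α = f̂-fixed 0 (κ-^q α)
  f̂-suc-κ (ℕ.suc i) α = f̂-fixed (ℕ.suc i) (trans (trans (^-congˡ q (f̂-suc-κ i α)) 0^q) (sym (f̂-suc-κ i α)))

  -- Raising the index multiplies every old exponent by q, and the new factor has exponent q^0.
  D-suc : ∀ i → D (ℕ.suc i) ≈ D i ^ q * [ ℕ.suc i ]
  D-suc i = begin
    D (ℕ.suc i)                                                               ≈⟨ ∏<-last i (λ k → [ ℕ.suc k ] ^ (q ℕ.^ (i ℕ.∸ k))) ⟩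
    ∏< i (λ k → [ ℕ.suc k ] ^ (q ℕ.^ (i ℕ.∸ k))) * [ ℕ.suc i ] ^ (q ℕ.^ (i ℕ.∸ i)) ≈⟨ *-cong (powers i (λ k k<i → step k<i)) (trans (reflexive (≡.cong (λ e → [ ℕ.suc i ] ^ (q ℕ.^ e)) (ℕₚ.n∸n≡0 i))) (*-identityʳ _)) ⟩
    D i ^ q * [ ℕ.suc i ]                                                     ∎
    where
    step : ∀ {k} → k ℕ.< i → [ ℕ.suc k ] ^ (q ℕ.^ (i ℕ.∸ k)) ≈ ([ ℕ.suc k ] ^ (q ℕ.^ (i ℕ.∸ ℕ.suc k))) ^ q
    step {k} k<i = trans (reflexive (≡.cong (λ e → [ ℕ.suc k ] ^ (q ℕ.^ e)) (ℕₚ.+-∸-assoc 1 k<i))) (^q^suc [ ℕ.suc k ] (i ℕ.∸ ℕ.suc k))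

    powers : ∀ n {a b : ℕ → Carrier} → (∀ k → k ℕ.< n → a k ≈ b k ^ q) → ∏< n a ≈ ∏< n b ^ q
    powers ℕ.zero    h = sym (1^n q)
    powers (ℕ.suc n) h = trans (*-cong (h 0 (s≤s z≤n)) (powers n (λ k k<n → h (ℕ.suc k) (s≤s k<n)))) (sym (^-distrib-* _ _ q))

  private
    module W = SumProperties *-commutativeMonoid

    word : ∀ {n} → (Fin n → Fin q) → Carrier
    word c = ι (poly (el ∘ c))

    word-cong : ∀ {n} {c d : Fin n → Fin q} → c ≗ d → word c ≈ word d
    word-cong c≗d = ι-cong (poly-cong (≡.cong el ∘ c≗d))
      where
      polyCoeff-cong : ∀ {n} {c d : Fin n → F.Carrier} → c ≗ d → ∀ k → Laurent.polyCoeff F c k F.≈ Laurent.polyCoeff F d k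
      polyCoeff-cong {ℕ.zero}  c≗d k         = FR.refl
      polyCoeff-cong {ℕ.suc n} c≗d ℕ.zero    = FR.reflexive (c≗d Fin.zero)
      polyCoeff-cong {ℕ.suc n} c≗d (ℕ.suc k) = polyCoeff-cong (c≗d ∘ Fin.suc) k

      poly-cong : ∀ {n} {c d : Fin n → F.Carrier} → c ≗ d → poly c ≈K poly d
      poly-cong c≗d (+ k)    = polyCoeff-cong c≗d k
      poly-cong c≗d -[1+ k ] = FR.refl

    word-suc : ∀ {n} (c : Fin (ℕ.suc n) → Fin q) → word c ≈ κ (el (c Fin.zero)) + X * word (c ∘ Fin.suc)
    word-suc c = trans (ι-cong (poly-suc (el ∘ c))) (trans (ι-+ _ _) (+-congˡ (ι-* _ _)))

    word-empty : ∀ (c : Fin 0 → Fin q) → word c ≈ 0#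
    word-empty c = trans (ι-cong {poly (el ∘ c)} {const F.0#} λ where
      (+ ℕ.zero)    → FR.refl
      (+ (ℕ.suc n)) → FR.refl
      -[1+ n ]      → FR.refl) κ-0

    word-snoc : ∀ {n} (c : Fin n → Fin q) b → word (W.snoc c b) ≈ word c + κ (el b) * X ^ n
    word-snoc {ℕ.zero} c b = begin
      word (W.snoc c b)                       ≈⟨ word-suc (W.snoc c b) ⟩
      κ (el b) + X * word (W.snoc c b ∘ Fin.suc) ≈⟨ +-congˡ (*-congˡ (word-empty _)) ⟩
      κ (el b) + X * 0#                       ≈⟨ solve 2 (λ k x → k :+ x :* con (+ 0) := con (+ 0) :+ k :* con (+ 1)) refl (κ (el b)) X ⟩
      0# + κ (el b) * 1#                      ≈⟨ +-congʳ (word-empty c) ⟨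
      word c + κ (el b) * 1#                  ∎
    word-snoc {ℕ.suc n} c b = begin
      word (W.snoc c b)                                   ≈⟨ word-suc (W.snoc c b) ⟩
      κ₀ + X * word (W.snoc (c ∘ Fin.suc) b)              ≈⟨ +-congˡ (*-congˡ (word-snoc (c ∘ Fin.suc) b)) ⟩
      κ₀ + X * (word (c ∘ Fin.suc) + κ (el b) * X ^ n)    ≈⟨ solve 5 (λ k x w b y → k :+ x :* (w :+ b :* y) := (k :+ x :* w) :+ b :* (x :* y)) refl κ₀ X (word (c ∘ Fin.suc)) (κ (el b)) (X ^ n) ⟩
      (κ₀ + X * word (c ∘ Fin.suc)) + κ (el b) * X ^ ℕ.suc n ≈⟨ +-congʳ (word-suc c) ⟨
      word c + κ (el b) * X ^ ℕ.suc n                     ∎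
      where κ₀ = κ (el (c Fin.zero))

    ∏-^ : ∀ {n} c (a : Fin n → Carrier) → ∏.sum (λ i → c * a i) ≈ c ^ n * ∏.sum a
    ∏-^ {n} c a = trans (∏.∑-distrib-+ {n} (λ _ → c) a) (*-congʳ (∏.sum-replicate n))

    -- A leading coefficient b shifts T to T - b x^n. By linearity and f_n(x^n) = 1 the product over
    -- the remaining coefficients is D_n (f_n(T) - b), and the product of f_n(T) - b over all b is
    -- f_n(T)^q - f_n(T).
    ∏words : ∀ n T → W.sumWords n (λ c → T - word c) ≈ D n * f̂ n T
    -- The only word of length 0 is the zero polynomial, so the product is T itself, in agreement
    -- with e_0(t) = t.
    ∏words ℕ.zero T = trans (+-congˡ (trans (-‿cong (word-empty _)) -0#≈0#)) (trans (+-identityʳ T) (sym (*-identityˡ T)))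
    ∏words (ℕ.suc n) T = begin
      W.sumWords (ℕ.suc n) (λ c → T - word c)                        ≈⟨ W.sumWords-snoc n (λ c → T - word c) (λ c≗d → +-congˡ (-‿cong (word-cong c≗d))) ⟩
      ∏.sum (λ b → W.sumWords n (λ c → T - word (W.snoc c b)))       ≈⟨ W.sum-cong q (λ b → W.sumWords-cong n (λ c → regroup b c)) ⟩
      ∏.sum (λ b → W.sumWords n (λ c → (T - κX b) - word c))         ≈⟨ W.sum-cong q (λ b → ∏words n (T - κX b)) ⟩
      ∏.sum (λ b → D n * f̂ n (T - κX b))                             ≈⟨ W.sum-cong q (λ b → *-congˡ (translate b)) ⟩
      ∏.sum (λ b → D n * (f̂ n T - κ (el b)))                         ≈⟨ ∏-^ (D n) (λ b → f̂ n T - κ (el b)) ⟩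
      D n ^ q * ∏.sum (λ b → f̂ n T - κ (el b))                       ≈⟨ *-congˡ (trans (∏[T-κ] (f̂ n T)) (sym (f̂-suc n T))) ⟩
      D n ^ q * (f̂ (ℕ.suc n) T * [ ℕ.suc n ])                        ≈⟨ solve 3 (λ d f k → d :* (f :* k) := d :* k :* f) refl (D n ^ q) _ [ ℕ.suc n ] ⟩
      D n ^ q * [ ℕ.suc n ] * f̂ (ℕ.suc n) T                          ≈⟨ *-congʳ (D-suc n) ⟨
      D (ℕ.suc n) * f̂ (ℕ.suc n) T                                    ∎
      where
      κX : Fin q → Carrier
      κX b = κ (el b) * X ^ n

      regroup : ∀ b (c : Fin n → Fin q) → T - word (W.snoc c b) ≈ (T - κX b) - word c
      regroup b c = trans (+-congˡ (-‿cong (word-snoc c b)))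
        (solve 3 (λ t w k → t :- (w :+ k) := (t :- k) :- w) refl T (word c) (κX b))

      translate : ∀ b → f̂ n (T - κX b) ≈ f̂ n T - κ (el b)
      translate b = trans (φ-sub (f̂-linear n) T (κX b))
        (+-congˡ (-‿cong (trans (φ-κ (f̂-linear n) (el b) (X ^ n)) (trans (*-congˡ (f̂-X^ n)) (*-identityʳ _)))))

  e≈D*f̂ : ∀ n t → e n t ≈ D n * f̂ n (ιO t)
  e≈D*f̂ ℕ.zero    t = sym (*-identityˡ _)
  e≈D*f̂ (ℕ.suc n) t = trans
    (W.sum-finToFun (ℕ.suc n) (λ c → ιO t - word c) (λ c≗d → +-congˡ (-‿cong (word-cong c≗d))))
    (∏words (ℕ.suc n) (ιO t))

  f≈f̂ : ∀ n t → f n t ≈ f̂ n (ιO t)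
  f≈f̂ n t = sym (/-unique (D#0 n) (trans (*-comm _ _) (sym (e≈D*f̂ n t))))

-- Carlitz quotients, indefinite sums and the integrals.

[r+s]-s : ∀ r s → (r ℚ.- s) ℚ.+ s ≡ r
[r+s]-s = +-*-Solver.solve 2 (λ r s → (r ℚS.:- s) ℚS.:+ s ℚS.:= r) ≡.refl
  where module ℚS = +-*-Solver

module CarlitzIntegrals
  {p γ : ℕ} (p-prime : Prime p) (γ≥1 : 1 ℕ.≤ γ)
  (F : HeytingField 0ℓ 0ℓ 0ℓ)
  (card : Inverse (≡.setoid (Fin (p ℕ.^ γ))) (FieldOps.setoid F))
  (K̄c : CompletedAlgebraicClosure F)
  where

  open CarlitzPolynomials p-prime γ≥1 F card K̄c public
  open SetoidReasoning (FieldOps.setoid K̄.completion)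
  open IsFLinear

  0O : O
  0O = constO F.0#

  1O : O
  1O = constO F.1#

  ιO-decompose : ∀ t → ιO t ≈ κ (coeff (val t) 0ℤ) + X * ιO (shift t)
  ιO-decompose t = trans (ι-cong (O-decompose t)) (trans (ι-+ _ _) (+-congˡ (ι-* _ _)))

  ιO-x* : ∀ t → ιO (xO *O t) ≈ X * ιO t
  ιO-x* t = ι-* xK (val t)

  ιO-x^ : ∀ n → ιO (xO ^O n) ≈ X ^ n
  ιO-x^ ℕ.zero    = κ-1
  ιO-x^ (ℕ.suc n) = trans (ιO-x* (xO ^O n)) (*-congˡ (ιO-x^ n))

  -- The recursion alone gives only |f_(i+1)| ≤ q. For t = α + x s the constant α is a root, so
  -- f_(i+1)(t) = x f_(i+1)(s) + f_i(s)^q, and the factor x absorbs the q.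
  ∣f̂∣≤1 : ∀ i t → ∣ f̂ i (ιO t) ∣≤q^- 0ℚ
  ∣f̂∣≤1 ℕ.zero    t = ∣O∣≤1 t
  ∣f̂∣≤1 (ℕ.suc i) t = resp (sym eq)
    (ultrametric (*-≤ ∣X∣≤q⁻¹ (∣f̂∣≤q (shift t))) (^-≤1 q (∣f̂∣≤1 i (shift t))))
    where
    ∣f̂∣≤q : ∀ t → ∣ f̂ (ℕ.suc i) (ιO t) ∣≤q^- (ℚ.- 1ℚ)
    ∣f̂∣≤q t = ≤1-* (sub-≤ (^-≤1 q (∣f̂∣≤1 i t)) (∣f̂∣≤1 i t)) (resp (*-identityˡ _) (∣1/[]∣≤q i))

    eq : f̂ (ℕ.suc i) (ιO t) ≈ X * f̂ (ℕ.suc i) (ιO (shift t)) + f̂ i (ιO (shift t)) ^ q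
    eq = begin
      f̂ (ℕ.suc i) (ιO t)                                       ≈⟨ φ-cong (f̂-linear (ℕ.suc i)) (ιO-decompose t) ⟩
      f̂ (ℕ.suc i) (κ (coeff (val t) 0ℤ) + X * ιO (shift t))    ≈⟨ φ-+ (f̂-linear (ℕ.suc i)) _ _ ⟩
      f̂ (ℕ.suc i) (κ (coeff (val t) 0ℤ)) + f̂ (ℕ.suc i) (X * ιO (shift t)) ≈⟨ +-cong (f̂-suc-κ i _) (f̂-X* (ℕ.suc i) _) ⟩
      0# + (X * f̂ (ℕ.suc i) (ιO (shift t)) + f̂ i (ιO (shift t)) ^ q) ≈⟨ +-identityˡ _ ⟩
      X * f̂ (ℕ.suc i) (ιO (shift t)) + f̂ i (ιO (shift t)) ^ q  ∎

  x^n≈x*x^[n-1] : ∀ x {n} → 1 ℕ.≤ n → x ^ n ≈ x * x ^ ℕ.pred n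
  x^n≈x*x^[n-1] x (s≤s _) = refl

  -- fᵢ (t) / t
  G : ℕ → Carrier → Carrier
  G ℕ.zero    T = 1#
  G (ℕ.suc i) T = G i T * ((f̂ i T ^ ℕ.pred q - 1#) / []#0 i)

  -- From a^q - a = a (a^(q-1) - 1), the step from f_i to f_(i+1) multiplies by (f_i^(q-1) - 1) /
  -- [i+1], which makes sense at T = 0 as well.
  f̂≈T*G : ∀ i T → f̂ i T ≈ T * G i T
  f̂≈T*G ℕ.zero    T = sym (*-identityʳ T)
  f̂≈T*G (ℕ.suc i) T = begin
    (a ^ q - a) * v               ≈⟨ *-congʳ (+-congʳ (x^n≈x*x^[n-1] a (ℕₚ.<⇒≤ 2≤q))) ⟩
    (a * b - a) * v               ≈⟨ solve 3 (λ a b v → (a :* b :- a) :* v := a :* ((b :- con 1ℤ) :* v)) refl a b v ⟩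
    a * ((b - 1#) * v)            ≈⟨ *-congʳ (f̂≈T*G i T) ⟩
    T * G i T * ((b - 1#) * v)    ≈⟨ *-assoc T _ _ ⟩
    T * G (ℕ.suc i) T             ∎
    where
    a b v : Carrier
    a = f̂ i T
    b = a ^ ℕ.pred q
    v = proj₁ (#⇒invertible ([]#0 i))

  -- At zero every factor of the product becomes -1/[j], because f_(j-1)(0) = 0 and q - 1 ≥ 1.
  G-0 : ∀ i {T} → T ≈ 0# → G i T * L i ≈ (- 1#) ^ i
  G-0 ℕ.zero    T≈0 = *-identityˡ 1#
  G-0 (ℕ.suc i) {T} T≈0 = begin
    G i T * ((b - 1#) / []#0 i) * L (ℕ.suc i)          ≈⟨ *-congˡ (∏<-last i (λ k → [ ℕ.suc k ])) ⟩
    G i T * ((b - 1#) / []#0 i) * (L i * [ ℕ.suc i ])  ≈⟨ solve 4 (λ g c l k → g :* c :* (l :* k) := (c :* k) :* (g :* l)) refl (G i T) _ (L i) [ ℕ.suc i ] ⟩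
    ((b - 1#) / []#0 i) * [ ℕ.suc i ] * (G i T * L i)  ≈⟨ *-cong ([x/z]*z _ ([]#0 i)) (G-0 i T≈0) ⟩
    (b - 1#) * (- 1#) ^ i                              ≈⟨ *-congʳ (trans (+-congʳ b≈0) (+-identityˡ _)) ⟩
    - 1# * (- 1#) ^ i                                  ∎
    where
    b : Carrier
    b = f̂ i T ^ ℕ.pred q
    b≈0 : b ≈ 0#
    b≈0 = 0^n≈0 (ℕₚ.pred-mono-≤ 2≤q) (trans (φ-cong (f̂-linear i) T≈0) (φ-0 (f̂-linear i)))

  G-0≈ : ∀ i {T} → T ≈ 0# → G i T ≈ (- 1#) ^ i / L#0 i
  G-0≈ i T≈0 = /-unique (L#0 i) (G-0 i T≈0)

  -- Each of the i factors of `G` costs at most a factor q. The multiplier `w` keeps the exponents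
  -- natural numbers; a bound for `G` alone would need the exponent -i.
  ∣G*w∣≤ : ∀ i t {w n} → ∣ w ∣≤q^- ⌜ i ℕ.+ n ⌝ → ∣ G i (ιO t) * w ∣≤q^- ⌜ n ⌝
  ∣G*w∣≤ ℕ.zero    t h = ≤1-* ∣1∣≤1 h
  ∣G*w∣≤ (ℕ.suc i) t {w} {n} h = resp (sym (*-assoc (G i (ιO t)) _ w)) (∣G*w∣≤ i t
    (resp (sym (*-assoc _ _ w)) (≤1-* (sub-≤ (^-≤1 (ℕ.pred q) (∣f̂∣≤1 i t)) ∣1∣≤1)
      (≡.subst (∣ v * w ∣≤q^-_) cancel (*-≤ {r = ℚ.- 1ℚ} (resp (*-identityˡ v) (∣1/[]∣≤q i)) h)))))
    where
    v : Carrier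
    v = proj₁ (#⇒invertible ([]#0 i))
    cancel : ℚ.- 1ℚ ℚ.+ ⌜ ℕ.suc i ℕ.+ n ⌝ ≡ ⌜ i ℕ.+ n ⌝
    cancel = ≡.trans (≡.cong (λ r → ℚ.- 1ℚ ℚ.+ r) (⌜⌝-suc (i ℕ.+ n)))
      (≡.trans (≡.sym (ℚₚ.+-assoc (ℚ.- 1ℚ) 1ℚ ⌜ i ℕ.+ n ⌝)) (ℚₚ.+-identityˡ _))

  Near : ℚ → O → O → Set
  Near s t′ t = ∣ val t′ -K val t ∣K≤q^- s

  near-antitone : ∀ {r s t′ t} → r ℚ.≤ s → Near s t′ t → Near r t′ t
  near-antitone r≤s h i i<r = h i (ℚₚ.<-≤-trans i<r r≤s)

  cont-cong : ∀ {u v} → (∀ t → u t ≈ v t) → Continuous u → Continuous v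
  cont-cong u≈v uc t r = proj₁ (uc t r) , λ t′ h →
    resp (+-cong (u≈v t′) (-‿cong (u≈v t))) (proj₂ (uc t r) t′ h)

  cont-const : ∀ c → Continuous (λ _ → c)
  cont-const c t r = 0ℚ , λ _ _ → ≈⇒≤ r refl

  cont-ι : Continuous ιO
  cont-ι t r = r , λ t′ h → resp (ι-sub _ _) (∣ι∣≤ h)

  cont-+ : ∀ {u v} → Continuous u → Continuous v → Continuous (λ t → u t + v t)
  cont-+ {u} {v} uc vc t r = proj₁ (uc t r) ℚ.⊔ proj₁ (vc t r) , λ t′ h →
    resp (solve 4 (λ a b c d → (a :- c) :+ (b :- d) := (a :+ b) :- (c :+ d)) refl (u t′) (v t′) (u t) (v t))
      (ultrametric (proj₂ (uc t r) t′ (near-antitone {t′ = t′} {t} (ℚₚ.p≤p⊔q (proj₁ (uc t r)) (proj₁ (vc t r))) h))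
                   (proj₂ (vc t r) t′ (near-antitone {t′ = t′} {t} (ℚₚ.p≤q⊔p (proj₁ (uc t r)) (proj₁ (vc t r))) h)))

  cont-* : ∀ {u v} → Continuous u → Continuous v → Continuous (λ t → u t * v t)
  cont-* {u} {v} uc vc t r = s₁ ℚ.⊔ s₂ ℚ.⊔ s₃ , λ t′ h →
    let near₁₂ = near-antitone {t′ = t′} {t} (ℚₚ.p≤p⊔q (s₁ ℚ.⊔ s₂) s₃) h
        h₁ = proj₂ (uc t a) t′ (near-antitone {t′ = t′} {t} (ℚₚ.p≤p⊔q s₁ s₂) near₁₂)
        h₂ = proj₂ (uc t (r ℚ.- b)) t′ (near-antitone {t′ = t′} {t} (ℚₚ.p≤q⊔p s₁ s₂) near₁₂)
        h₃ = proj₂ (vc t (r ℚ.- a)) t′ (near-antitone {t′ = t′} {t} (ℚₚ.p≤q⊔p (s₁ ℚ.⊔ s₂) s₃) h)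
        -- Closeness within the bound `a` of `u t` gives `u t′` the same bound: local boundedness in
        -- ultrametric form.
        u′≤ = resp (solve 2 (λ x y → (x :- y) :+ y := x) refl (u t′) (u t)) (ultrametric h₁ (proj₂ (finite (u t))))
    in resp (solve 4 (λ a b c d → (b :- d) :* a :+ (a :- c) :* d := a :* b :- c :* d) refl (u t′) (v t′) (u t) (v t))
         (ultrametric
           (≡.subst (∣ (v t′ - v t) * u t′ ∣≤q^-_) ([r+s]-s r a) (*-≤ h₃ u′≤))
           (≡.subst (∣ (u t′ - u t) * v t ∣≤q^-_) ([r+s]-s r b) (*-≤ h₂ (proj₂ (finite (v t))))))
    where
    a b s₁ s₂ s₃ : ℚ
    a = proj₁ (finite (u t))
    b = proj₁ (finite (v t))
    s₁ = proj₁ (uc t a)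
    s₂ = proj₁ (uc t (r ℚ.- b))
    s₃ = proj₁ (vc t (r ℚ.- a))

  cont-^ : ∀ {u} n → Continuous u → Continuous (λ t → u t ^ n)
  cont-^ ℕ.zero    uc = cont-const 1#
  cont-^ (ℕ.suc n) uc = cont-* uc (cont-^ n uc)

  cont-∑< : ∀ n (u : ℕ → O → Carrier) → (∀ i → Continuous (u i)) → Continuous (λ t → ∑< n (λ i → u i t))
  cont-∑< ℕ.zero    u uc = cont-const 0#
  cont-∑< (ℕ.suc n) u uc = cont-+ (uc 0) (cont-∑< n (u ∘ ℕ.suc) (uc ∘ ℕ.suc))

  cont-minus : ∀ {u} c → Continuous u → Continuous (λ t → u t - c)
  cont-minus c uc = cont-+ uc (cont-const (- c))

  -- The two are proved together: f_i is continuous as t times its quotient, and the next quotient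
  -- is made from f_i.
  G-cont : ∀ i → Continuous (λ t → G i (ιO t))
  f̂-cont : ∀ i → Continuous (λ t → f̂ i (ιO t))
  G-cont ℕ.zero    = cont-const 1#
  G-cont (ℕ.suc i) = cont-* (G-cont i) (cont-* (cont-minus 1# (cont-^ (ℕ.pred q) (f̂-cont i))) (cont-const _))
  f̂-cont i = cont-cong (λ t → sym (f̂≈T*G i (ιO t))) (cont-* cont-ι (G-cont i))

  -- A function on O is not assumed to respect equality of series. Continuity supplies this, since
  -- equal series are within every distance of each other.
  cont-ext : ∀ {u} → Continuous u → ∀ {s t} → val s ≈K val t → u s ≈ u t
  cont-ext uc {s} {t} s≈t = ≤⇒≈ λ n → proj₂ (uc t ⌜ n ⌝) s
    (λ i _ → FR.trans (FR.+-congʳ (s≈t i)) (FR.-‿inverseʳ _))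

  record IsLinear (u : O → Carrier) : Set where
    field
      additive    : ∀ s t → u (s +O t) ≈ u s + u t
      homogeneous : ∀ α t → u (constO α *O t) ≈ κ α * u t

  φ-linear : ∀ {φ} → IsFLinear φ → IsLinear (λ t → φ (ιO t))
  φ-linear l = record
    { additive    = λ s t → trans (φ-cong l (ι-+ (val s) (val t))) (φ-+ l _ _)
    ; homogeneous = λ α t → trans (φ-cong l (ι-* (const α) (val t))) (φ-κ l α _)
    }

  linear-cong : ∀ {u v} → (∀ t → u t ≈ v t) → IsLinear u → IsLinear v
  linear-cong u≈v ul = record
    { additive    = λ s t → trans (sym (u≈v _)) (trans (IsLinear.additive ul s t) (+-cong (u≈v s) (u≈v t)))
    ; homogeneous = λ α t → trans (sym (u≈v _)) (trans (IsLinear.homogeneous ul α t) (*-congˡ (u≈v t)))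
    }

  linear-C₀ : ∀ {u} → Continuous u → IsLinear u → C₀ u
  linear-C₀ uc ul = record { continuous = uc ; additive = IsLinear.additive ul ; homogeneous = IsLinear.homogeneous ul }

  -- Uniqueness of the indefinite sum.

  module Uniqueness {g u v} (u-sum : IsIndefiniteSum g u) (v-sum : IsIndefiniteSum g v) where

    module U = IsIndefiniteSum u-sum
    module V = IsIndefiniteSum v-sum
    module U₀ = C₀ U.inC₀
    module V₀ = C₀ V.inC₀

    w : O → Carrier
    w t = u t - v t

    -- The constant digit of t is α times 1, where u vanishes by homogeneity and u(1) = 0. Only the
    -- part divisible by x remains, and the difference equation evaluates it.
    expand : ∀ {u} → IsIndefiniteSum g u → ∀ t → u t ≈ X * u (shift t) + g (shift t) ^ q
    expand {u} u-sum t = begin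
      u t                                       ≈⟨ cont-ext continuous decompose ⟩
      u ((constO α *O 1O) +O (xO *O shift t))   ≈⟨ additive _ _ ⟩
      u (constO α *O 1O) + u (xO *O shift t)    ≈⟨ +-congʳ (trans (homogeneous α 1O) (trans (*-congˡ initial) (zeroʳ _))) ⟩
      0# + u (xO *O shift t)                    ≈⟨ solve 3 (λ a x b → con 0ℤ :+ a := x :* b :+ (a :- x :* b)) refl _ X (u (shift t)) ⟩
      X * u (shift t) + (u (xO *O shift t) - X * u (shift t)) ≈⟨ +-congˡ (difference (shift t)) ⟩
      X * u (shift t) + g (shift t) ^ q         ∎
      where
      open IsIndefiniteSum u-sum
      open C₀ inC₀
      α : F.Carrier
      α = coeff (val t) 0ℤ
      decompose : val t ≈K val ((constO α *O 1O) +O (xO *O shift t))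
      decompose i = FR.trans (O-decompose t i) (FR.+-congʳ (FR.trans
        (const-cong (FR.sym (FR.*-identityʳ α)) i) (const-* α F.1# i)))

    w-shift : ∀ t → w t ≈ X * w (shift t)
    w-shift t = trans (+-cong (expand u-sum t) (-‿cong (expand v-sum t)))
      (solve 4 (λ x a b c → (x :* a :+ c) :- (x :* b :+ c) := x :* (a :- b)) refl X _ _ _)

    w-x* : ∀ t → w (xO *O t) ≈ X * w t
    w-x* t = begin
      u (xO *O t) - v (xO *O t)                        ≈⟨ solve 5 (λ a b x c d → a :- b := ((a :- x :* c) :- (b :- x :* d)) :+ x :* (c :- d)) refl _ _ X (u t) (v t) ⟩
      ((u (xO *O t) - X * u t) - (v (xO *O t) - X * v t)) + X * w t ≈⟨ +-congʳ (+-cong (U.difference t) (-‿cong (V.difference t))) ⟩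
      (g t ^ q - g t ^ q) + X * w t                    ≈⟨ +-congʳ (-‿inverseʳ _) ⟩
      0# + X * w t                                     ≈⟨ +-identityˡ _ ⟩
      X * w t                                          ∎

    -- The witness is t with its n lowest digits erased: w(t) = x w(`shift t`) = w(x `shift t`), and
    -- the induction erases the further digits inside `shift t`.
    w-divide : ∀ n t → ∃ λ t′ → ∣ ιO t′ ∣≤q^- ⌜ n ⌝ × w t ≈ w t′
    w-divide ℕ.zero    t = t , ∣O∣≤1 t , refl
    w-divide (ℕ.suc n) t =
      let t′ , h , eq = w-divide n (shift t)
      in xO *O t′ ,
         ≡.subst (∣ ιO (xO *O t′) ∣≤q^-_) (≡.sym (⌜⌝-suc n)) (resp (sym (ιO-x* t′)) (*-≤ ∣X∣≤q⁻¹ h)) ,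
         trans (w-shift t) (trans (*-congˡ eq) (sym (w-x* t′)))

    w-cont : Continuous w
    w-cont = cont-+ U₀.continuous (cont-cong (λ t → -1*x≈-x (v t)) (cont-* (cont-const (- 1#)) V₀.continuous))

    u-0O : ∀ {u} → C₀ u → u 0O ≈ 0#
    u-0O {u} c = begin
      u 0O                     ≈⟨ cont-ext (C₀.continuous c) (λ i → FR.trans (const-cong (FR.sym (FR.zeroˡ F.0#)) i) (const-* F.0# F.0# i)) ⟩
      u (constO F.0# *O 0O)    ≈⟨ C₀.homogeneous c F.0# 0O ⟩
      κ F.0# * u 0O            ≈⟨ *-congʳ κ-0 ⟩
      0# * u 0O                ≈⟨ zeroˡ _ ⟩
      0#                       ∎

    w≈0 : ∀ t → w t ≈ 0#
    w≈0 t = ≤⇒≈0 λ n →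
      let s , near = w-cont 0O ⌜ n ⌝
          N , s≤N = archimedean s
          t′ , h , eq = w-divide N t
          h′ = near t′ (∣ι∣≤⁻¹ {val t′ -K val 0O} (resp (sym (trans (ι-sub _ _) (trans (+-congˡ (trans (-‿cong κ-0) -0#≈0#)) (+-identityʳ _)))) (antitone s≤N h)))
      in resp (trans (trans (+-congˡ (trans (-‿cong w-0O) -0#≈0#)) (+-identityʳ _)) (sym eq)) h′
      where
      w-0O : w 0O ≈ 0#
      w-0O = trans (+-cong (u-0O U.inC₀) (-‿cong (u-0O V.inC₀))) (-‿inverseʳ 0#)

    unique : ∀ t → u t ≈ v t
    unique t = trans (solve 2 (λ a b → a := (a :- b) :+ b) refl (u t) (v t)) (trans (+-congʳ (w≈0 t)) (+-identityˡ _))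

  integral-from-quotients : ∀ {g H S R I} → IsLinear g → IsLinear S → Continuous H → Continuous R →
    (∀ t → g t ≈ ιO t * H t) → (∀ t → S t ≈ ιO t * R t) →
    (∀ t → S (xO *O t) - X * S t ≈ g t ^ q) → S 1O ≈ 0# → R 0O ≈ I → HasIntegral g I
  integral-from-quotients {g} {H} {S} {R} {I} gl Sl Hc Rc g≈ S≈ difference initial R0≈I = record
    { inC₀¹ = record
      { inC₀                = linear-C₀ (cont-cong (λ t → sym (g≈ t)) (cont-* cont-ι Hc)) gl
      ; quotient            = H
      ; quotient-continuous = Hc
      ; quotient-extends    = λ t t#0 → /-unique t#0 (trans (*-comm _ _) (sym (g≈ t)))
      }
    ; S        = S
    ; S-sum    = S-sum
    ; S-unique = λ u u-sum → Uniqueness.unique u-sum S-sum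
    ; limit    = limit
    }
    where
    S-sum : IsIndefiniteSum g S
    S-sum = record
      { inC₀       = linear-C₀ (cont-cong (λ t → sym (S≈ t)) (cont-* cont-ι Rc)) Sl
      ; difference = difference
      ; initial    = initial
      }

    S/x^n : ∀ n → S (xO ^O n) / ^-#0 X#0 n ≈ R (xO ^O n)
    S/x^n n = sym (/-unique (^-#0 X#0 n) (trans (*-comm _ _) (trans (*-congʳ (sym (ιO-x^ n))) (sym (S≈ (xO ^O n))))))

    limit : Limit (λ n → S (xO ^O n) / ^-#0 X#0 n) I
    limit r =
      let s , near = Rc 0O r
          N , s≤N = archimedean s
      in N , λ n N≤n → resp (+-cong (sym (S/x^n n)) (-‿cong R0≈I))
        (near (xO ^O n) (∣ι∣≤⁻¹ {val (xO ^O n) -K val 0O}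
          (resp (sym (trans (ι-sub _ _) (trans (+-cong (ιO-x^ n) (trans (-‿cong κ-0) -0#≈0#)) (+-identityʳ _))))
            (antitone (ℚₚ.≤-trans s≤N (⌜⌝-mono N≤n)) (^-≤⌜⌝ n ∣X∣≤q⁻¹)))))

  1≤q^ : ∀ n → 1 ℕ.≤ q ℕ.^ n
  1≤q^ n = ℕₚ.≤-trans (s≤s z≤n) (n<q^n 2≤q n)

  -- With Q = q^(n+1) and v = 1/[n+1] the quotients are t^(q^n - 1) and (t^(Q-1) - 1) v; the latter
  -- is -v at 0. The difference equation holds because (x^Q - x) v = 1.
  integral-power : ∀ n → HasIntegral (λ t → ιO t ^ (q ℕ.^ n)) (- (1# / []#0 n))
  integral-power n = integral-from-quotients
    (φ-linear (^q^n-linear n)) (φ-linear (*-linear v (sub-linear (^q^n-linear (ℕ.suc n)) id-linear)))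
    (cont-^ (ℕ.pred (q ℕ.^ n)) cont-ι)
    (cont-* (cont-minus 1# (cont-^ (ℕ.pred (q ℕ.^ ℕ.suc n)) cont-ι)) (cont-const v))
    (λ t → x^n≈x*x^[n-1] (ιO t) (1≤q^ n))
    (λ t → trans (*-congʳ (+-congʳ (x^n≈x*x^[n-1] (ιO t) (1≤q^ (ℕ.suc n)))))
      (solve 3 (λ x y v → (x :* y :- x) :* v := x :* ((y :- con 1ℤ) :* v)) refl (ιO t) _ v))
    difference
    (trans (*-congʳ (+-cong (trans (^-congˡ (q ℕ.^ ℕ.suc n) κ-1) (1^n (q ℕ.^ ℕ.suc n))) (-‿cong κ-1))) (trans (*-congʳ (-‿inverseʳ 1#)) (zeroˡ v)))
    (trans (*-congʳ (+-congʳ (0^n≈0 (ℕₚ.pred-mono-≤ (ℕₚ.≤-trans (s≤s (s≤s z≤n)) (n<q^n 2≤q (ℕ.suc n)))) κ-0)))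
      (solve 1 (λ v → (con 0ℤ :- con 1ℤ) :* v := :- (con 1ℤ :* v)) refl v))
    where
    v : Carrier
    v = proj₁ (#⇒invertible ([]#0 n))
    Q : ℕ
    Q = q ℕ.^ ℕ.suc n
    difference : ∀ t → (ιO (xO *O t) ^ Q - ιO (xO *O t)) * v - X * ((ιO t ^ Q - ιO t) * v) ≈ (ιO t ^ (q ℕ.^ n)) ^ q
    difference t = begin
      (ιO (xO *O t) ^ Q - ιO (xO *O t)) * v - X * ((T ^ Q - T) * v)  ≈⟨ +-congʳ (*-congʳ (+-cong (trans (^-congˡ Q (ιO-x* t)) (^-distrib-* X T Q)) (-‿cong (ιO-x* t)))) ⟩
      (X ^ Q * T ^ Q - X * T) * v - X * ((T ^ Q - T) * v)  ≈⟨ solve 5 (λ y u x t v → (y :* u :- x :* t) :* v :- x :* ((u :- t) :* v) := u :* (con 1ℤ :* v :* (y :- x))) refl (X ^ Q) (T ^ Q) X T v ⟩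
      T ^ Q * (1# * v * [ ℕ.suc n ])                       ≈⟨ *-congˡ ([x/z]*z 1# ([]#0 n)) ⟩
      T ^ Q * 1#                                           ≈⟨ *-identityʳ _ ⟩
      T ^ Q                                                ≈⟨ ^q^suc T n ⟩
      (T ^ (q ℕ.^ n)) ^ q                                  ∎
      where
      T : Carrier
      T = ιO t

  integral-f : ∀ n → HasIntegral (f n) ((- 1#) ^ ℕ.suc n / L#0 (ℕ.suc n))
  integral-f n = integral-from-quotients
    (linear-cong (λ t → sym (f≈f̂ n t)) (φ-linear (f̂-linear n))) (φ-linear (f̂-linear (ℕ.suc n)))
    (G-cont n) (G-cont (ℕ.suc n))
    (λ t → trans (f≈f̂ n t) (f̂≈T*G n (ιO t))) (λ t → f̂≈T*G (ℕ.suc n) (ιO t))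
    (λ t → trans (+-congʳ (trans (φ-cong (f̂-linear (ℕ.suc n)) (ιO-x* t)) (f̂-X* (ℕ.suc n) (ιO t))))
      (trans (solve 2 (λ a b → (a :+ b) :- a := b) refl _ _) (^-congˡ q (sym (f≈f̂ n t)))))
    -- The initial condition holds because 1 is a constant, and all constants are roots of f_(n+1).
    (f̂-suc-κ n F.1#)
    (G-0≈ (ℕ.suc n) κ-0)

  -- Series with prescribed rate, the Carlitz function and the logarithm.

  ∑<-cong : ∀ n {a b : ℕ → Carrier} → (∀ i → a i ≈ b i) → ∑< n a ≈ ∑< n b
  ∑<-cong n a≈b = ∑.sum-cong-≋ {n} (a≈b ∘ toℕ)

  ∑<-* : ∀ n c (a : ℕ → Carrier) → ∑< n (λ i → c * a i) ≈ c * ∑< n a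
  ∑<-* ℕ.zero    c a = sym (zeroʳ c)
  ∑<-* (ℕ.suc n) c a = trans (+-congˡ (∑<-* n c (a ∘ ℕ.suc))) (sym (distribˡ c _ _))

  sumsTo-unique : ∀ {a b l m} → (∀ i → a i ≈ b i) → SumsTo a l → SumsTo b m → l ≈ m
  sumsTo-unique {a} {b} a≈b al bm = ≤⇒≈ λ n →
    via-≤ (∑< n a) (swap-≤ (remainder al n)) (resp (+-congʳ (sym (∑<-cong n a≈b))) (remainder bm n))

  sumsTo-+ : ∀ {a b l m} → SumsTo a l → SumsTo b m → SumsTo (λ i → a i + b i) (l + m)
  sumsTo-+ {a} {b} {l} {m} al bm = sumsTo λ n → resp
    (trans (solve 4 (λ x y l m → (x :- l) :+ (y :- m) := (x :+ y) :- (l :+ m)) refl (∑< n a) (∑< n b) l m)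
           (+-congʳ (sym (∑.∑-distrib-+ {n} (a ∘ toℕ) (b ∘ toℕ)))))
    (ultrametric (remainder al n) (remainder bm n))

  sumsTo-* : ∀ {a l} c → ∣ c ∣≤q^- 0ℚ → SumsTo a l → SumsTo (λ i → c * a i) (c * l)
  sumsTo-* {a} {l} c c≤1 al = sumsTo λ n → resp
    (trans (solve 3 (λ c x l → c :* (x :- l) := c :* x :- c :* l) refl c (∑< n a) l) (+-congʳ (sym (∑<-* n c a))))
    (≤1-* c≤1 (remainder al n))

  sumsTo-cong : ∀ {a b l} → (∀ i → a i ≈ b i) → SumsTo a l → SumsTo b l
  sumsTo-cong a≈b al = sumsTo λ n → resp (+-congʳ (∑<-cong n a≈b)) (remainder al n)

  -- The absolute value is discrete on K: a bound with exponent r > 0 kills all coefficients of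
  -- index at most 0, which is already the bound 1/q.
  ∣<1∣⇒≤q⁻¹ : ∀ {z} → ∣ z ∣<1 → ∣ ι z ∣≤q^- 1ℚ
  ∣<1∣⇒≤q⁻¹ {z} (r , 0<r , h) = ∣ι∣≤ {z} λ i i<1 → h i (ℚₚ.≤-<-trans (≤0 i (fromℤ-cancel-< {j = 1ℤ} i<1)) 0<r)
    where
    ≤0 : ∀ i → i ℤ.< 1ℤ → fromℤ i ℚ.≤ 0ℚ
    ≤0 i i<1 = ℚ.*≤* (ℤₚ.*-monoʳ-≤-nonNeg 1ℤ (ℤₚ.i<j⇒i≤pred[j] i<1))


  ∣G*z^q^i∣≤ : ∀ {z} → ∣ z ∣≤q^- 1ℚ → ∀ t i → ∣ G i (ιO t) * z ^ (q ℕ.^ i) ∣≤q^- ⌜ i ⌝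
  ∣G*z^q^i∣≤ h t i = ∣G*w∣≤ i t (antitone (⌜⌝-mono (2n≤q^n 2≤q i)) (^-≤⌜⌝ (q ℕ.^ i) h))

  -- Q t stands for C_t(z) / t.
  module CarlitzFunction (z : Carrier) (Q : O → Carrier)
    (Q-sum : ∀ t → SumsTo (λ i → G i (ιO t) * z ^ (q ℕ.^ i)) (Q t)) where

    ζ : ℕ → Carrier
    ζ i = z ^ (q ℕ.^ i)

    C : O → Carrier
    C t = ιO t * Q t

    C-sum : ∀ t → SumsTo (λ i → f̂ i (ιO t) * ζ i) (C t)
    C-sum t = sumsTo-cong (λ i → trans (sym (*-assoc _ _ _)) (*-congʳ (sym (f̂≈T*G i (ιO t)))))
      (sumsTo-* (ιO t) (∣O∣≤1 t) (Q-sum t))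

    Q-cont : Continuous Q
    Q-cont t r =
      let N , r≤N = archimedean r
          s , near = cont-∑< N (λ i t → G i (ιO t) * ζ i) (λ i → cont-* (G-cont i) (cont-const (ζ i))) t r
      in s , λ t′ h → via-≤ _ (antitone r≤N (swap-≤ (remainder (Q-sum t′) N))) (via-≤ _ (near t′ h) (antitone r≤N (remainder (Q-sum t) N)))

    C-linear : IsLinear C
    C-linear = record
      { additive    = λ s t → sumsTo-unique
          (λ i → trans (*-congʳ (IsLinear.additive (φ-linear (f̂-linear i)) s t)) (distribʳ (ζ i) _ _))
          (C-sum (s +O t)) (sumsTo-+ (C-sum s) (C-sum t))
      ; homogeneous = λ α t → sumsTo-unique
          (λ i → trans (*-congʳ (IsLinear.homogeneous (φ-linear (f̂-linear i)) α t)) (*-assoc (κ α) _ _))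
          (C-sum (constO α *O t)) (sumsTo-* (κ α) (∣κ∣≤1 α) (C-sum t))
      }

    ∑<-^q : ∀ n (a : ℕ → Carrier) → ∑< n (λ i → a i ^ q) ≈ ∑< n a ^ q
    ∑<-^q ℕ.zero    a = sym 0^q
    ∑<-^q (ℕ.suc n) a = trans (+-congˡ (∑<-^q n (a ∘ ℕ.suc))) (sym (^q-+ _ _))

    -- By `f̂-X*` the i-th term of the left side is f_(i-1)(t)^q z^(q^i) = (f_(i-1)(t)
    -- z^(q^(i-1)))^q, and it is 0 for i = 0. So n + 1 terms on the left sum to the q-th power of n
    -- terms of C(t), and additivity of the q-th power carries the remainder estimate over.
    C-x* : ∀ t → C (xO *O t) - X * C t ≈ C t ^ q
    C-x* t = ≤⇒≈ λ n → via-≤ (∑< n (λ i → f̂ i T * ζ i) ^ q)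
      (swap-≤ (resp (+-congʳ (Δ-partial n)) (antitone (⌜⌝-mono (ℕₚ.n≤1+n n)) (remainder Δ-sum (ℕ.suc n)))))
      (resp (^q-sub _ _) (^-≤ q (ℕₚ.<⇒≤ 2≤q) (0≤⌜⌝ n) (remainder (C-sum t) n)))
      where
      T : Carrier
      T = ιO t

      Δ-sum : SumsTo (λ i → Δf̂ i T * ζ i) (C (xO *O t) - X * C t)
      Δ-sum = sumsTo λ n → resp (+-cong (∑<-cong n eq) (-‿cong (+-congˡ neg))) (remainder (sumsTo-+ (C-sum (xO *O t)) (sumsTo-* (- X) (neg-≤ (∣O∣≤1 xO)) (C-sum t))) n)
        where
        neg : - X * C t ≈ - (X * C t)
        neg = solve 2 (λ x c → (:- x) :* c := :- (x :* c)) refl X (C t)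
        eq : ∀ i → f̂ i (ιO (xO *O t)) * ζ i + - X * (f̂ i T * ζ i) ≈ Δf̂ i T * ζ i
        eq i = trans (+-congʳ (*-congʳ (trans (φ-cong (f̂-linear i) (ιO-x* t)) (f̂-X* i T))))
          (solve 4 (λ x f d z → (x :* f :+ d) :* z :+ (:- x) :* (f :* z) := d :* z) refl X (f̂ i T) (Δf̂ i T) (ζ i))

      Δ-partial : ∀ n → ∑< (ℕ.suc n) (λ i → Δf̂ i T * ζ i) ≈ ∑< n (λ i → f̂ i T * ζ i) ^ q
      Δ-partial n = begin
        0# * ζ 0 + ∑< n (λ i → f̂ i T ^ q * ζ (ℕ.suc i))  ≈⟨ trans (+-congʳ (zeroˡ _)) (+-identityˡ _) ⟩
        ∑< n (λ i → f̂ i T ^ q * ζ (ℕ.suc i))             ≈⟨ ∑<-cong n (λ i → trans (*-congˡ (^q^suc z i)) (sym (^-distrib-* (f̂ i T) (ζ i) q))) ⟩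
        ∑< n (λ i → (f̂ i T * ζ i) ^ q)                   ≈⟨ ∑<-^q n (λ i → f̂ i T * ζ i) ⟩
        ∑< n (λ i → f̂ i T * ζ i) ^ q                     ∎

    -- All f_i with i ≥ 1 vanish at 1, so every partial sum with at least one term equals z.
    C-1 : C 1O ≈ z
    C-1 = ≤⇒≈ λ n → via-≤ _ (swap-≤ (antitone (⌜⌝-mono (ℕₚ.n≤1+n n)) (remainder (C-sum 1O) (ℕ.suc n))))
      (resp (trans (solve 2 (λ a s → s := (a :+ s) :- a) refl _ _) (+-congˡ (-‿cong head)))
        (∑<-≤ n (λ i → f̂ (ℕ.suc i) (κ F.1#) * ζ (ℕ.suc i)) (λ i → resp (sym (trans (*-congʳ (f̂-suc-κ i F.1#)) (zeroˡ _))) (∣0∣≤ _))))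
      where
      head : κ F.1# * (z * 1#) ≈ z
      head = trans (*-cong κ-1 (*-identityʳ z)) (*-identityˡ z)

    -- `C` solves its own difference equation but takes the value z at 1. Subtracting t z, a
    -- solution of u(x t) = x u(t), corrects the initial value, and this is the origin of the term
    -- -z in the integral.
    integral-C : HasIntegral C (Q 0O - z)
    integral-C = integral-from-quotients C-linear S-linear Q-cont (cont-minus z Q-cont) (λ _ → refl)
      (λ t → solve 3 (λ t q z → t :* q :- t :* z := t :* (q :- z)) refl (ιO t) (Q t) z)
      (λ t → trans (+-congʳ (+-congˡ (-‿cong (*-congʳ (ιO-x* t)))))
        (trans (solve 5 (λ c′ x t z c → (c′ :- x :* t :* z) :- x :* (c :- t :* z) := c′ :- x :* c) refl _ X (ιO t) z (C t)) (C-x* t)))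
      (trans (+-cong C-1 (-‿cong (trans (*-congʳ κ-1) (*-identityˡ z)))) (-‿inverseʳ z))
      refl
      where
      tz-linear : IsLinear (λ t → ιO t * z)
      tz-linear = φ-linear (*-linear z id-linear)
      S-linear : IsLinear (λ t → C t - ιO t * z)
      S-linear = record
        { additive    = λ s t → trans (+-cong (IsLinear.additive C-linear s t) (-‿cong (IsLinear.additive tz-linear s t)))
            (solve 4 (λ a b c d → (a :+ b) :- (c :+ d) := (a :- c) :+ (b :- d)) refl _ _ _ _)
        ; homogeneous = λ α t → trans (+-cong (IsLinear.homogeneous C-linear α t) (-‿cong (IsLinear.homogeneous tz-linear α t)))
            (solve 3 (λ a b c → a :* b :- a :* c := a :* (b :- c)) refl _ _ _)
        }

  integral-C : ∀ z → ∣ z ∣<1 → ∃₂ λ C ℓ → IsCarlitzFunction z C × IsCarlitzLog z ℓ × HasIntegral C (ℓ - ι z)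
  integral-C z z<1 = CF.C , Q 0O , carlitz , log , CF.integral-C
    where
    Q-exists : ∀ t → ∃ (SumsTo (λ i → G i (ιO t) * ι z ^ (q ℕ.^ i)))
    Q-exists t = sum-exists _ (∣G*z^q^i∣≤ (∣<1∣⇒≤q⁻¹ z<1) t)

    Q : O → Carrier
    Q t = proj₁ (Q-exists t)

    module CF = CarlitzFunction (ι z) Q (λ t → proj₂ (Q-exists t))

    carlitz : IsCarlitzFunction z CF.C
    carlitz s = SumsTo⇒HasSum (sumsTo-cong (λ i → *-congʳ (sym (f≈f̂ i s))) (CF.C-sum s))

    log : IsCarlitzLog z (Q 0O)
    log = SumsTo⇒HasSum (sumsTo-cong
      (λ i → trans (*-congʳ (G-0≈ i κ-0)) (solve 3 (λ a v z → (a :* v) :* z := a :* (z :* v)) refl _ _ _))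
      (proj₂ (Q-exists 0O)))

open import Data.Nat.Base using (suc)
open import Relation.Binary.PropositionalEquality using (setoid)

theorem4 : ∀ (p γ : ℕ) (p-prime : Prime p) (γ≥1 : 1 ℕ.≤ γ)
    (F : HeytingField 0ℓ 0ℓ 0ℓ)
    (card : Inverse (setoid (Fin (p ℕ.^ γ))) (FieldOps.setoid F))
    (K̄c : CompletedAlgebraicClosure F) →
    let open Carlitz p-prime γ≥1 F card K̄c in
    (∀ n → HasIntegral (λ t → ιO t ^ (q ℕ.^ n)) (- (1# / []#0 n)))
    × (∀ n → HasIntegral (f n) ((- 1#) ^ suc n / L#0 (suc n)))
    × (∀ z → ∣ z ∣<1 →
    ∃₂ λ C ℓ → IsCarlitzFunction z C × IsCarlitzLog z ℓ
    × HasIntegral C (ℓ - ι z))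
theorem4 p γ p-prime γ≥1 F card K̄c = integral-power , integral-f , integral-C
  where open CarlitzIntegrals p-prime γ≥1 F card K̄c
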